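{- Let $n\ge 4$ be an even integer and let $\mathscr{A}$ and $\mathscr{B}$ be two antichains of $\mathbb{N}_n$. Suppose that for some integer $k\le\min\{|\mathscr{A}|,|\mathscr{B}|\}$ the members can be enumerated as $\mathscr{A}=\{A_1,A_2,\dots\}$, $\mathscr{B}=\{B_1,B_2,\dots\}$ so that for all $A_i\in\mathscr{A}$, $B_j\in\mathscr{B}$, $A_i\cap B_j=\emptyset$ only if $i=j\le k$. If $$|\mathscr{A}|+|\mathscr{B}|=\binom{n}{n/2}+\binom{n}{n/2+1}-\kappa^*_{n/2}(k),$$ then for each $\mathscr{X}\in\{\mathscr{A},\mathscr{B}\}$: (i) $\mathscr{X}\subseteq\binom{\mathbb{N}_n}{n/2}\cup\binom{\mathbb{N}_n}{n/2+1}$; (ii) $\mathscr{X}=\mathscr{X}^{(n/2)}\cup\Big(\binom{\mathbb{N}_n}{n/2+1}\setminus\nabla\mathscr{X}^{(n/2)}\Big)$; (iii) $|\nabla\mathscr{X}^{(n/2)}|=|\nabla L_{n,n/2}(|\mathscr{X}^{(n/2)}|)|$.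
   Context: An antichain of $\mathbb{N}_n=\{1,\dots,n\}$ is a family of subsets no member of which is contained in another. $\binom{\mathbb{N}_n}{r}$ denotes the family of all $r$-subsets of $\mathbb{N}_n$, and $\mathscr{X}^{(r)}=\mathscr{X}\cap\binom{\mathbb{N}_n}{r}$. For a family $\mathscr{F}$ of $r$-sets, its shade is $\nabla\mathscr{F}=\{X\subseteq\mathbb{N}_n:|X|=r+1, Y\subset X\text{ for some }Y\in\mathscr{F}\}$ and its shadow is $\Delta\mathscr{F}=\{X:|X|=r-1, X\subset Y\text{ for some }Y\in\mathscr{F}\}$. Squashed order on $r$-subsets: $A<_s B$ if $A\ne B$ and the largest element of the symmetric difference of $A$ and $B$ lies in $B$. $F_{n,r}(m)$ (resp. $L_{n,r}(m)$) is the family of the first (resp. last) $m$ $r$-subsets of $\mathbb{N}_n$ in squashed order. Every nonnegative integer $m$ has a unique $r$-binomial representation $m=\sum_{i=t}^{r}\binom{a_i}{i}$ with $a_r>\dots>a_t\ge t\ge1$ (empty for $m=0$). The Kruskal–Katona function is $\kappa_r(m):=\sum_{i=t}^r\binom{a_i}{i-1}-m$ (which equals $|\Delta F_{n,r}(m)|-m$ for $m\le\binom nr$), and $\kappa^*_r(m):=\min_{0\le j\le m}\kappa_r(j)$. -}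

module Defs where

open import Data.Nat using (ℕ; zero; suc; _+_; _∸_; _≤_; _<_; _≤ᵇ_)
import Data.Nat as ℕ
open import Data.Nat.Combinatorics using (_C_)
open import Data.Integer as ℤ using (ℤ; +_; _-_; _⊓_)
open import Data.Bool using (Bool; true; false; if_then_else_)
import Data.Bool as 𝔹
open import Data.Fin using (Fin)
import Data.Fin as Fin
open import Data.Fin.Properties using (any?; all?)
open import Data.Fin.Subset using (Subset; _∈_; _∉_; _⊂_; ∣_∣)
open import Data.Fin.Subset.Properties using (_∈?_; _⊂?_)
open import Data.Vec using (Vec; []; _∷_; lookup)
open import Data.Vec.Properties using (≡-dec)
open import Data.Product using (Σ; ∃; _×_; _,_; proj₁; proj₂)
open import Data.Sum using (_⊎_)
open import Relation.Nullary using (Dec; yes; no; ¬_)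
open import Relation.Nullary.Decidable using (_×-dec_; _→-dec_; ¬?)
open import Relation.Binary.PropositionalEquality using (_≡_; _≢_)

-- Generic finite machinery over subsets of ℕ_n (Subset n = Vec Bool n;
-- position i : Fin n stands for the element (toℕ i + 1) of ℕ_n).

exists? : ∀ {n} {P : Subset n → Set} → (∀ S → Dec (P S)) → Dec (∃ P)
exists? {zero} P? with P? []
... | yes p = yes ([] , p)
... | no ¬p = no λ { ([] , p) → ¬p p }
exists? {suc n} {P} P? with exists? (λ S → P? (true ∷ S)) | exists? (λ S → P? (false ∷ S))
... | yes (S , p) | _ = yes (true ∷ S , p)
... | no _ | yes (S , p) = yes (false ∷ S , p)
... | no ¬t | no ¬f = no λ { (true ∷ S , p) → ¬t (S , p) ; (false ∷ S , p) → ¬f (S , p) }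

count : ∀ {n} {P : Subset n → Set} → (∀ S → Dec (P S)) → ℕ
count {zero} P? with P? []
... | yes _ = 1
... | no _ = 0
count {suc n} P? = count (λ S → P? (true ∷ S)) + count (λ S → P? (false ∷ S))

Mem : ∀ {n p} → (Fin p → Subset n) → Subset n → Set
Mem a S = ∃ λ i → a i ≡ S

Mem? : ∀ {n p} (a : Fin p → Subset n) → ∀ S → Dec (Mem a S)
Mem? a S = any? (λ i → ≡-dec 𝔹._≟_ (a i) S)

Antichain : ∀ {n p} → (Fin p → Subset n) → Set
Antichain a = ∀ i j → a i ≢ a j → ¬ (a i ⊂ a j)

Level : ∀ {n p} → (Fin p → Subset n) → ℕ → Subset n → Set
Level a r S = Mem a S × ∣ S ∣ ≡ r

Level? : ∀ {n p} (a : Fin p → Subset n) r → ∀ S → Dec (Level a r S)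
Level? a r S = Mem? a S ×-dec (∣ S ∣ ℕ.≟ r)

Shade : ∀ {n} → ℕ → (Subset n → Set) → Subset n → Set
Shade r F X = ∣ X ∣ ≡ suc r × ∃ λ Y → F Y × Y ⊂ X

Shade? : ∀ {n} r {F : Subset n → Set} → (∀ S → Dec (F S)) → ∀ X → Dec (Shade r F X)
Shade? r F? X = (∣ X ∣ ℕ.≟ suc r) ×-dec exists? (λ Y → F? Y ×-dec (Y ⊂? X))

-- Squashed order: A <ₛ B iff A ≠ B and the largest element of the
-- symmetric difference of A and B lies in B; i.e. there is an element i
-- with i ∉ A, i ∈ B, and A, B agree on all elements larger than i.
SqLt : ∀ {n} → Subset n → Subset n → Set
SqLt {n} A B = ∃ λ (i : Fin n) → i ∉ A × i ∈ B × (∀ j → i Fin.< j → lookup A j ≡ lookup B j)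

SqLt? : ∀ {n} (A B : Subset n) → Dec (SqLt A B)
SqLt? A B = any? (λ i → ¬? (i ∈? A) ×-dec (i ∈? B) ×-dec
                   all? (λ j → (i Fin.<? j) →-dec (lookup A j 𝔹.≟ lookup B j)))

-- L_{n,r}(m): the last m r-subsets of ℕ_n in squashed order, i.e. the
-- r-sets S such that fewer than m r-sets come after S.
L : ∀ n → ℕ → ℕ → Subset n → Set
L n r m S = ∣ S ∣ ≡ r × count (λ T → (∣ T ∣ ℕ.≟ r) ×-dec SqLt? S T) < m

L? : ∀ n r m → ∀ S → Dec (L n r m S)
L? n r m S = (∣ S ∣ ℕ.≟ r) ×-dec (count (λ T → (∣ T ∣ ℕ.≟ r) ×-dec SqLt? S T) ℕ.<? m)

-- Kruskal–Katona function via the r-binomial representation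
-- m = C(a_r,r) + C(a_{r-1},r-1) + ... + C(a_t,t), a_r > ... > a_t ≥ t ≥ 1,
-- computed greedily: a_r is the largest a with C(a,r) ≤ m (for r ≥ 1 and
-- m ≥ 1 it satisfies a ≤ m + r), then recurse on m - C(a_r,r) with r-1.

topA : ℕ → ℕ → ℕ → ℕ
topA r m zero = zero
topA r m (suc b) = if (suc b C r) ≤ᵇ m then suc b else topA r m b

shadowSum : ℕ → ℕ → ℕ
shadowSum zero m = zero
shadowSum (suc r) zero = zero
shadowSum (suc r) (suc m) =
  let a = topA (suc r) (suc m) (suc m + suc r)
  in (a C r) + shadowSum r (suc m ∸ (a C suc r))

κ : ℕ → ℕ → ℤ
κ r m = + shadowSum r m - + m

κ* : ℕ → ℕ → ℤ
κ* r zero = κ r zero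
κ* r (suc m) = κ* r m ⊓ κ r (suc m)

Conclusion : ∀ n h {p} → (Fin p → Subset n) → Set
Conclusion n h x =
  (∀ i → ∣ x i ∣ ≡ h ⊎ ∣ x i ∣ ≡ suc h)
  × (∀ S → (Mem x S → Level x h S ⊎ (∣ S ∣ ≡ suc h × ¬ Shade h (Level x h) S))
         × (Level x h S ⊎ (∣ S ∣ ≡ suc h × ¬ Shade h (Level x h) S) → Mem x S))
  × count (Shade? h (Level? x h))
      ≡ count (Shade? h (L? n h (count (Level? x h))))

module Submission where

-- In A, push everything below the middle level h = n/2 up to the family U of
-- all h-sets above a member, and everything above h down to h + 1; this
-- only enlarges A, strictly so if A has a member outside the levels h and
-- h + 1.  In B, push the members below h up along symmetric
-- chains, each to a single h-set; the resulting family Y has at most k members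
-- whose complement lies in U.  Hence |A| + |B| is at most
--   |U| − |∇U| + |Y| − |∇Y| + 2 C(n, h + 1)   with   |U| + |Y| ≤ C(n, h) + k,
-- and the bound C(n, h) + C(n, h + 1) − κ*(k) follows from the inequality
--   s(x) + s(y) ≥ s(N) + s(j)   for   x + y = N + j,   N = C(n, h),
-- for the shadow function s of Kruskal–Katona.  Equality forces equality in
-- every step, which is the conclusion for A; the one for B is symmetric.

open import Defs
open import Data.Bool using (Bool; true; false; T; _∧_)
import Data.Bool as 𝔹
open import Data.Bool.Properties using (not-involutive)
open import Data.Empty using (⊥-elim)
open import Data.Fin as Fin using (Fin; zero; suc; toℕ; fromℕ<; splitAt; _↑ˡ_; _↑ʳ_)
open import Data.Fin.Properties
  using (injective⇒≤; splitAt-↑ˡ; splitAt-↑ʳ; splitAt⁻¹-↑ˡ; splitAt⁻¹-↑ʳ; toℕ-injective; toℕ-fromℕ<; any?)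
open import Data.Fin.Subset using (Subset; ∣_∣; ∁; _∩_; ⊥; _⊆_; _⊂_; _∈_)
open import Data.Fin.Subset.Properties
import Data.Integer as ℤ
import Data.Integer.Properties as ℤₚ
open import Data.Integer.Tactic.RingSolver using () renaming (solve-∀ to solveℤ-∀)
open import Data.Nat hiding (∣_-_∣)
open import Data.Nat.Combinatorics using (_C_; nCk+nC[k+1]≡[n+1]C[k+1]; nCn≡1)
open import Data.Nat.Properties
open import Data.Nat.Tactic.RingSolver using (solve-∀)
open import Data.Product using (∃; _×_; _,_; proj₁; proj₂)
open import Data.Sum using (_⊎_; inj₁; inj₂)
import Data.Sum as Sum
open import Data.Vec
  using (Vec; []; _∷_; _∷ʳ_; lookup; replicate; zipWith; allFin; map; initLast; here; there)
open import Data.Vec.N-ary using (N-ary; _$ⁿ_)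
open import Data.Vec.Properties using (≡-dec; ∷-injectiveʳ; ∷ʳ-injectiveˡ; ∷ʳ-injectiveʳ)
open import Function using (_∘_)
open import Function.Definitions using (Injective)
open import Relation.Binary.PropositionalEquality
open import Relation.Nullary using (yes; no; ¬_; contradiction)
open import Relation.Nullary.Decidable using (_×-dec_; _⊎-dec_)
open import Relation.Unary using (Decidable)

-- The two antichains are treated differently in order to keep the excess at most k. If T is in U
-- and its complement is in Y, then T contains some A_i and its complement contains some B_j; these
-- are disjoint, so i = j ≤ k. Each B_j sends only one set to Y, so j determines T. Had B also been
-- replaced by all h-sets above its members, one disjoint pair could account for many T. About j =
-- |U| + |Y| - N only j ≤ k is known, which is where the minimum κ* enters. If |U| + |Y| < N there
-- is no such j, and the case is excluded by the LYM-type bound (h + 1) s(x) ≥ h x. The inequality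
-- for s says that, among the windows of a given length in the list of increments of s, the last one
-- has the smallest sum. It is proved for the recursively built list itself, with no families of
-- sets involved.

private variable
  n : ℕ
  F G H : Subset n → Set

-- Linear arithmetic over ℕ

infixl 6 _:+_
infix 4 _:≤_ _:≡_
infixr 3 _⇒_

data Lin (n : ℕ) : Set where
  var  : Fin n → Lin n
  lit  : ℕ → Lin n
  _:+_ : Lin n → Lin n → Lin n

⟦_⟧ : ∀ {n} → Lin n → Vec ℕ n → ℕ
⟦ var i ⟧ ρ = lookup ρ i
⟦ lit k ⟧ ρ = k
⟦ s :+ t ⟧ ρ = ⟦ s ⟧ ρ + ⟦ t ⟧ ρ

data Rel (n : ℕ) : Set where
  _:≤_ _:≡_ : Lin n → Lin n → Rel n

data Sequent (n : ℕ) : Set where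
  goal : Lin n → Lin n → Sequent n
  _⇒_  : Rel n → Sequent n → Sequent n

⟦_⟧ᵣ : ∀ {n} → Rel n → Vec ℕ n → Set
⟦ s :≤ t ⟧ᵣ ρ = ⟦ s ⟧ ρ ≤ ⟦ t ⟧ ρ
⟦ s :≡ t ⟧ᵣ ρ = ⟦ s ⟧ ρ ≡ ⟦ t ⟧ ρ

⟦_⟧ₛ : ∀ {n} → Sequent n → Vec ℕ n → Set
⟦ goal s t ⟧ₛ ρ = ⟦ s ⟧ ρ ≤ ⟦ t ⟧ ρ
⟦ h ⇒ q ⟧ₛ ρ = ⟦ h ⟧ᵣ ρ → ⟦ q ⟧ₛ ρ

Row : ℕ → Set
Row n = ℕ × Vec ℕ n

unit : ∀ {n} → Fin n → Vec ℕ n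
unit zero = 1 ∷ replicate _ 0
unit (suc i) = 0 ∷ unit i

row : ∀ {n} → Lin n → Row n
row (var i) = 0 , unit i
row (lit k) = k , replicate _ 0
row (s :+ t) with row s | row t
... | a , x | b , y = a + b , zipWith _+_ x y

dot : ∀ {n} → Vec ℕ n → Vec ℕ n → ℕ
dot [] [] = 0
dot (a ∷ x) (r ∷ ρ) = a * r + dot x ρ

dot-zero : ∀ {n} (ρ : Vec ℕ n) → dot (replicate _ 0) ρ ≡ 0
dot-zero [] = refl
dot-zero (r ∷ ρ) = dot-zero ρ

dot-unit : ∀ {n} (i : Fin n) ρ → dot (unit i) ρ ≡ lookup ρ i
dot-unit zero (r ∷ ρ) = trans (cong (r + 0 +_) (dot-zero ρ)) (trans (+-identityʳ _) (+-identityʳ r))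
dot-unit (suc i) (r ∷ ρ) = dot-unit i ρ

dot-+ : ∀ {n} (x y ρ : Vec ℕ n) → dot (zipWith _+_ x y) ρ ≡ dot x ρ + dot y ρ
dot-+ [] [] [] = refl
dot-+ (a ∷ x) (b ∷ y) (r ∷ ρ) = trans (cong ((a + b) * r +_) (dot-+ x y ρ)) (arrange a b r _ _)
  where
  arrange : ∀ a b r s t → (a + b) * r + (s + t) ≡ (a * r + s) + (b * r + t)
  arrange = solve-∀

row-sound : ∀ {n} (t : Lin n) ρ → let (a , x) = row t in ⟦ t ⟧ ρ ≡ a + dot x ρ
row-sound (var i) ρ = sym (dot-unit i ρ)
row-sound (lit k) ρ = sym (trans (cong (k +_) (dot-zero ρ)) (+-identityʳ k))
row-sound (s :+ t) ρ with row s | row t | row-sound s ρ | row-sound t ρ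
... | a , x | b , y | p | q =
  trans (cong₂ _+_ p q) (trans (arrange a b _ _) (cong (a + b +_) (sym (dot-+ x y ρ))))
  where
  arrange : ∀ a b s t → (a + s) + (b + t) ≡ (a + b) + (s + t)
  arrange = solve-∀

_≤ᵛ_ : ∀ {n} → Vec ℕ n → Vec ℕ n → Bool
[] ≤ᵛ [] = true
(a ∷ x) ≤ᵛ (b ∷ y) = (a ≤ᵇ b) ∧ (x ≤ᵛ y)

∧-T : ∀ {b c} → T (b ∧ c) → T b × T c
∧-T {true} p = _ , p

≤ᵛ-sound : ∀ {n} (x y ρ : Vec ℕ n) → T (x ≤ᵛ y) → dot x ρ ≤ dot y ρ
≤ᵛ-sound [] [] [] _ = z≤n
≤ᵛ-sound (a ∷ x) (b ∷ y) (r ∷ ρ) p with ∧-T {a ≤ᵇ b} p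
... | p₁ , p₂ = +-mono-≤ (*-monoˡ-≤ r (≤ᵇ⇒≤ a b p₁)) (≤ᵛ-sound x y ρ p₂)

_≤ʳ_ : ∀ {n} → Lin n → Lin n → Bool
s ≤ʳ t with row s | row t
... | a , x | b , y = (a ≤ᵇ b) ∧ (x ≤ᵛ y)

≤ʳ-sound : ∀ {n} (s t : Lin n) ρ → T (s ≤ʳ t) → ⟦ s ⟧ ρ ≤ ⟦ t ⟧ ρ
≤ʳ-sound s t ρ p with row s | row t | row-sound s ρ | row-sound t ρ
... | a , x | b , y | es | et with ∧-T {a ≤ᵇ b} p
... | p₁ , p₂ = subst₂ _≤_ (sym es) (sym et) (+-mono-≤ (≤ᵇ⇒≤ a b p₁) (≤ᵛ-sound x y ρ p₂))

-- Adding up the hypotheses sᵢ ≤ tᵢ, the goal s ≤ t holds as soon as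
-- s + Σ tᵢ ≤ t + Σ sᵢ coefficientwise.
valid : ∀ {n} → Lin n → Lin n → Sequent n → Bool
valid L R (goal s t) = (s :+ R) ≤ʳ (t :+ L)
valid L R ((s :≤ t) ⇒ q) = valid (L :+ s) (R :+ t) q
valid L R ((s :≡ t) ⇒ q) = valid (L :+ s) (R :+ t) q

valid-sound : ∀ {n} (L R : Lin n) q ρ → T (valid L R q) → ⟦ L ⟧ ρ ≤ ⟦ R ⟧ ρ → ⟦ q ⟧ₛ ρ
valid-sound L R (goal s t) ρ p l = +-cancelʳ-≤ (⟦ L ⟧ ρ) _ _
  (≤-trans (+-monoʳ-≤ (⟦ s ⟧ ρ) l) (≤ʳ-sound (s :+ R) (t :+ L) ρ p))
valid-sound L R ((s :≤ t) ⇒ q) ρ p l h = valid-sound (L :+ s) (R :+ t) q ρ p (+-mono-≤ l h)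
valid-sound L R ((s :≡ t) ⇒ q) ρ p l h = valid-sound (L :+ s) (R :+ t) q ρ p (+-mono-≤ l (≤-reflexive h))

vars : ∀ n → Vec (Lin n) n
vars n = map var (allFin n)

-- Proof by reflection: the implicit argument is settled by evaluating `valid`. Every hypothesis is
-- added exactly once, and an equation counts only as left ≤ right; so a fact used twice is passed
-- twice, and the direction of each equation matters.
lin : ∀ {n} (ρ : Vec ℕ n) (f : N-ary n (Lin n) (Sequent n)) →
      {T (valid (lit 0) (lit 0) (f $ⁿ vars n))} → ⟦ f $ⁿ vars n ⟧ₛ ρ
lin {n} ρ f {p} = valid-sound (lit 0) (lit 0) (f $ⁿ vars n) ρ p z≤n

-- The numerical Kruskal–Katona function

-- Listing the u-subsets of a (u + v)-set in squashed order, let w(S) be the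
-- number of (u − 1)-sets that are in the shadow of S but of no earlier set.
-- The list w has length c u v = C(u + v, u) and is the concatenation of the
-- lists for (u, v − 1) and (u − 1, v).  P u v m and Q u v m are the sums of its
-- first and of its last m entries (of all entries if m > c u v), and Tot u v is
-- the sum of all entries.  By complementation, P u v m is also the size of the
-- shade of the last m v-subsets.
c : ℕ → ℕ → ℕ
c zero v = 1
c (suc u) zero = 1
c (suc u) (suc v) = c (suc u) v + c u (suc v)

P Q : ℕ → ℕ → ℕ → ℕ
P zero v m = 0
P (suc u) zero zero = 0
P (suc u) zero (suc m) = suc u
P (suc u) (suc v) m = P (suc u) v m + P u (suc v) (m ∸ c (suc u) v)

Q zero v m = 0
Q (suc u) zero zero = 0
Q (suc u) zero (suc m) = suc u
Q (suc u) (suc v) m = Q u (suc v) m + Q (suc u) v (m ∸ c u (suc v))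

Tot : ℕ → ℕ → ℕ
Tot zero v = 0
Tot (suc u) v = c u (suc v)

c>0 : ∀ u v → 1 ≤ c u v
c>0 zero v = s≤s z≤n
c>0 (suc u) zero = s≤s z≤n
c>0 (suc u) (suc v) = ≤-trans (c>0 (suc u) v) (m≤m+n _ _)

c-zeroʳ : ∀ u → c u 0 ≡ 1
c-zeroʳ zero = refl
c-zeroʳ (suc u) = refl

c-oneʳ : ∀ u → c u 1 ≡ suc u
c-oneʳ zero = refl
c-oneʳ (suc u) = cong suc (c-oneʳ u)

c-oneˡ : ∀ v → c 1 v ≡ suc v
c-oneˡ zero = refl
c-oneˡ (suc v) = trans (cong (_+ 1) (c-oneˡ v)) (+-comm (suc v) 1)

Tot-suc : ∀ u v → Tot (suc u) (suc v) ≡ Tot (suc u) v + Tot u (suc v)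
Tot-suc zero v = refl
Tot-suc (suc u) v = refl

c-absorb : ∀ u v → suc u * c (suc u) v ≡ suc v * c u (suc v)
c-absorb u zero = trans (*-identityʳ (suc u)) (sym (trans (+-identityʳ _) (c-oneʳ u)))
c-absorb zero (suc v) = trans (+-identityʳ _) (trans (c-oneˡ (suc v)) (sym (*-identityʳ _)))
c-absorb (suc u) (suc v) = arrange {c (2 + u) v} (c-absorb (suc u) v) (c-absorb u (suc v))
  where
  expand₁ : ∀ u A M → (2 + u) * (A + M) ≡ (2 + u) * A + (2 + u) * M
  expand₁ = solve-∀
  expand₂ : ∀ u v M → suc v * M + (2 + u) * M ≡ (2 + v) * M + suc u * M
  expand₂ = solve-∀
  arrange : ∀ {A M B} → (2 + u) * A ≡ suc v * M → suc u * M ≡ (2 + v) * B →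
            (2 + u) * (A + M) ≡ (2 + v) * (M + B)
  arrange {A} {M} {B} p q = trans (expand₁ u A M) (trans (cong (_+ (2 + u) * M) p)
    (trans (expand₂ u v M) (trans (cong ((2 + v) * M +_) q) (sym (*-distribˡ-+ (2 + v) M B)))))

-- By `c-absorb` the three entries are neighbours in a row of Pascal's triangle whose ratios decide
-- the matter: the middle one dominates the first if u + 1 ≤ v + 2, and the third otherwise.
c-unimodal : ∀ u v {y} → y ≤ c u (2 + v) → y ≤ c (2 + u) v → y ≤ c (suc u) (suc v)
c-unimodal u v p q with ≤-total (suc u) (2 + v)
... | inj₁ l = ≤-trans p (*-cancelˡ-≤ (suc u) (≤-trans (*-monoˡ-≤ _ l)
                 (≤-reflexive (sym (c-absorb u (suc v))))))
... | inj₂ g = ≤-trans q (*-cancelˡ-≤ (suc v) (≤-trans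
                 (*-monoˡ-≤ _ (≤-trans (n≤1+n _) (≤-trans g (n≤1+n _))))
                 (≤-reflexive (c-absorb (suc u) v))))

P-zero : ∀ u v → P u v 0 ≡ 0
P-zero zero v = refl
P-zero (suc u) zero = refl
P-zero (suc u) (suc v) rewrite 0∸n≡0 (c (suc u) v) = cong₂ _+_ (P-zero (suc u) v) (P-zero u (suc v))

Q-zero : ∀ u v → Q u v 0 ≡ 0
Q-zero zero v = refl
Q-zero (suc u) zero = refl
Q-zero (suc u) (suc v) rewrite 0∸n≡0 (c u (suc v)) = cong₂ _+_ (Q-zero u (suc v)) (Q-zero (suc u) v)

P-mono : ∀ u v {m m'} → m ≤ m' → P u v m ≤ P u v m'
P-mono zero v l = z≤n
P-mono (suc u) zero {zero} l = z≤n
P-mono (suc u) zero {suc m} (s≤s l) = ≤-refl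
P-mono (suc u) (suc v) l =
  +-mono-≤ (P-mono (suc u) v l) (P-mono u (suc v) (∸-monoˡ-≤ (c (suc u) v) l))

Q-mono : ∀ u v {m m'} → m ≤ m' → Q u v m ≤ Q u v m'
Q-mono zero v l = z≤n
Q-mono (suc u) zero {zero} l = z≤n
Q-mono (suc u) zero {suc m} (s≤s l) = ≤-refl
Q-mono (suc u) (suc v) l =
  +-mono-≤ (Q-mono u (suc v) l) (Q-mono (suc u) v (∸-monoˡ-≤ (c u (suc v)) l))

P-sat : ∀ u v {m} → c u v ≤ m → P u v m ≡ Tot u v
P-sat zero v l = refl
P-sat (suc u) zero {suc m} l = sym (c-oneʳ u)
P-sat (suc u) (suc v) {m} l = trans
  (cong₂ _+_ (P-sat (suc u) v (≤-trans (m≤m+n _ _) l))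
             (P-sat u (suc v) (m+n≤o⇒m≤o∸n (c u (suc v)) (≤-trans (≤-reflexive (+-comm (c u (suc v)) _)) l))))
  (sym (Tot-suc u v))

Q-sat : ∀ u v {m} → c u v ≤ m → Q u v m ≡ Tot u v
Q-sat zero v l = refl
Q-sat (suc u) zero {suc m} l = sym (c-oneʳ u)
Q-sat (suc u) (suc v) {m} l = trans
  (cong₂ _+_ (Q-sat u (suc v) (≤-trans (m≤n+m _ _) l))
             (Q-sat (suc u) v (m+n≤o⇒m≤o∸n (c (suc u) v) l)))
  (trans (+-comm (Tot u (suc v)) _) (sym (Tot-suc u v)))

P-left : ∀ u v {m} → m ≤ c (suc u) v → P (suc u) (suc v) m ≡ P (suc u) v m
P-left u v {m} l rewrite m≤n⇒m∸n≡0 l | P-zero u (suc v) = +-identityʳ _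

P-right : ∀ u v {m} y → m ≡ c (suc u) v + y →
          P (suc u) (suc v) m ≡ Tot (suc u) v + P u (suc v) y
P-right u v y refl = cong₂ _+_ (P-sat (suc u) v (m≤m+n _ _))
  (cong (P u (suc v)) (m+n∸m≡n (c (suc u) v) y))

Q-left : ∀ u v {m} → m ≤ c u (suc v) → Q (suc u) (suc v) m ≡ Q u (suc v) m
Q-left u v {m} l rewrite m≤n⇒m∸n≡0 l | Q-zero (suc u) v = +-identityʳ _

Q-right : ∀ u v {m} y → m ≡ c u (suc v) + y →
          Q (suc u) (suc v) m ≡ Tot u (suc v) + Q (suc u) v y
Q-right u v y refl = cong₂ _+_ (Q-sat u (suc v) (m≤m+n _ _))
  (cong (Q (suc u) v) (m+n∸m≡n (c u (suc v)) y))

compare-+ : ∀ m n → m ≤ n ⊎ ∃ λ y → m ≡ n + y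
compare-+ m n with ≤-total m n
... | inj₁ l = inj₁ l
... | inj₂ g = inj₂ (m ∸ n , sym (m+[n∸m]≡n g))

P+Q : ∀ u v m z → m + z ≡ c u v → P u v m + Q u v z ≡ Tot u v
P+Q zero v m z e = refl
P+Q (suc u) zero zero (suc zero) e = sym (c-oneʳ u)
P+Q (suc u) zero (suc zero) zero e = trans (+-identityʳ _) (sym (c-oneʳ u))
P+Q (suc u) (suc v) m z e with compare-+ m (c (suc u) v)
... | inj₁ l with m≤n⇒∃[o]m+o≡n l
... | y , e' = trans (cong₂ _+_ (P-left u v l) (Q-right u v y z≡))
        (trans (arrange (P (suc u) v m) _ _) (trans (cong (_+ Tot u (suc v)) (P+Q (suc u) v m y e')) (sym (Tot-suc u v))))
  where
  z≡ : z ≡ c u (suc v) + y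
  z≡ = +-cancelˡ-≡ m _ _ (trans e (trans (cong (_+ c u (suc v)) (sym e'))
         (trans (+-assoc m y _) (cong (m +_) (+-comm y _)))))
  arrange : ∀ p t q → p + (t + q) ≡ (p + q) + t
  arrange = solve-∀
P+Q (suc u) (suc v) m z e | inj₂ (y , refl) = trans
  (cong₂ _+_ (P-right u v y refl) (Q-left u v (≤-trans (m≤n+m z y) (≤-reflexive e'))))
  (trans (+-assoc (Tot (suc u) v) _ _) (trans (cong (Tot (suc u) v +_) (P+Q u (suc v) y z e')) (sym (Tot-suc u v))))
  where
  e' : y + z ≡ c u (suc v)
  e' = +-cancelˡ-≡ (c (suc u) v) _ _ (trans (sym (+-assoc (c (suc u) v) y z)) e)

-- Among the windows of a given length in the list w, the last one has the
-- smallest sum and the first one the largest; moving from (u, v + 1) to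
-- (u + 1, v) increases the sums of first and last entries.  The four statements
-- are proved by a simultaneous induction on u + v.
SuffixMinimal Subadditive SuffixMonotone PrefixMonotone : ℕ → ℕ → Set
SuffixMinimal u v = ∀ a z → a + z ≤ c u v → P u v a + Q u v z ≤ P u v (a + z)
Subadditive u v = ∀ a b → P u v (a + b) ≤ P u v a + P u v b
SuffixMonotone u v = ∀ z → z ≤ c (suc u) v → Q u (suc v) z ≤ Q (suc u) v z
PrefixMonotone u v = ∀ z → z ≤ c (suc u) v → P u (suc v) z ≤ P (suc u) v z

-- With a entries in front, the difference of `Q u v (d + g)` and `Q u v d` is the window of g
-- entries just before the last d, to which `SuffixMinimal` applies.
Q-superadditive : ∀ u v → SuffixMinimal u v → ∀ d g → d + g ≤ c u v → Q u v d + Q u v g ≤ Q u v (d + g)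
Q-superadditive u v suf d g l with m≤n⇒∃[o]m+o≡n l
... | a , e = lin (P u v a ∷ Q u v g ∷ P u v (a + g) ∷ Q u v (d + g) ∷ Q u v d ∷ Tot u v ∷ [])
  (λ pa qg pag qdg qd t → pa :+ qg :≤ pag ⇒ t :≡ pa :+ qdg ⇒ pag :+ qd :≡ t ⇒ goal (qd :+ qg) qdg)
  (suf a g (≤-trans (lin (a ∷ d ∷ g ∷ []) (λ a d g → goal (a :+ g) (d :+ g :+ a))) (≤-reflexive e)))
  (sym (P+Q u v a (d + g) (trans (+-comm a _) e)))
  (P+Q u v (a + g) d (trans (arrange a d g) e))
  where
  arrange : ∀ a d g → a + g + d ≡ d + g + a
  arrange = solve-∀

-- The window of e entries just before the last d is bounded by the first e entries, by
-- `Subadditive`.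
Q-subadditive : ∀ u v → Subadditive u v → ∀ d e → d + e ≤ c u v → Q u v (d + e) ≤ Q u v d + P u v e
Q-subadditive u v sub d e l with m≤n⇒∃[o]m+o≡n l
... | a , eq = lin (P u v a ∷ P u v e ∷ P u v (a + e) ∷ Q u v (d + e) ∷ Q u v d ∷ Tot u v ∷ [])
  (λ pa pe pae qde qd t → pae :≤ pa :+ pe ⇒ pa :+ qde :≡ t ⇒ t :≡ pae :+ qd ⇒ goal qde (qd :+ pe))
  (sub a e)
  (P+Q u v a (d + e) (trans (+-comm a _) eq))
  (sym (P+Q u v (a + e) d (trans (arrange a d e) eq)))
  where
  arrange : ∀ a d g → a + g + d ≡ d + g + a
  arrange = solve-∀

-- The list W is A, for (u + 1, v), followed by B, for (u, v + 1). The window of z entries after the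
-- first a lies in A (`case₁`), crosses the border (`case₃`) or lies in B. The last z entries of W
-- start from the end of B, and `SuffixMonotone` exchanges an end of B for an end of A of the same
-- length.
suffixMinimal-step : ∀ u v → SuffixMinimal (suc u) v → SuffixMinimal u (suc v) → Subadditive u (suc v) → SuffixMonotone u v → SuffixMinimal (suc u) (suc v)
suffixMinimal-step u v sufA sufB subB dq a z h = go (compare-+ (a + z) cA) (compare-+ z cB) (compare-+ a cA)
  where
  cA = c (suc u) v
  cB = c u (suc v)
  PA = P (suc u) v
  PB = P u (suc v)
  QA = Q (suc u) v
  QB = Q u (suc v)
  PW = P (suc u) (suc v)
  QW = Q (suc u) (suc v)
  TA = Tot (suc u) v
  TB = Tot u (suc v)
  case₁ : a + z ≤ cA → z ≤ cB ⊎ (∃ λ y → z ≡ cB + y) → PW a + QW z ≤ PW (a + z)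
  case₁ l (inj₁ z≤) = lin (PW a ∷ PA a ∷ QW z ∷ QB z ∷ QA z ∷ PA (a + z) ∷ PW (a + z) ∷ [])
    (λ p p' q qb qa p″ r → p :≡ p' ⇒ q :≡ qb ⇒ qb :≤ qa ⇒ p' :+ qa :≤ p″ ⇒ p″ :≡ r ⇒ goal (p :+ q) r)
    (P-left u v (≤-trans (m≤m+n a z) l)) (Q-left u v z≤) (dq z (≤-trans (m≤n+m z a) l))
    (sufA a z l) (sym (P-left u v l))
  case₁ l (inj₂ (y , refl)) =
    lin (PW a ∷ PA a ∷ QW z ∷ TB ∷ QA y ∷ QA cB ∷ PA (a + cB) ∷ PA (a + cB + y) ∷ PW (a + z) ∷ QB cB ∷ [])
    (λ p p' q tb qy qc s t r qb → p :≡ p' ⇒ q :≡ tb :+ qy ⇒ tb :≡ qb ⇒ qb :≤ qc ⇒ p' :+ qc :≤ s ⇒ s :+ qy :≤ t ⇒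
       t :≡ r ⇒ goal (p :+ q) r)
    (P-left u v (≤-trans (m≤m+n a z) l)) (Q-right u v y refl) (sym (Q-sat u (suc v) ≤-refl))
    (dq cB (≤-trans (m≤n+m cB a) acB≤)) (sufA a cB acB≤) (sufA (a + cB) y l')
    (trans (cong PA (+-assoc a cB y)) (sym (P-left u v l)))
    where
    l' : a + cB + y ≤ cA
    l' = ≤-trans (≤-reflexive (+-assoc a cB y)) l
    acB≤ : a + cB ≤ cA
    acB≤ = ≤-trans (m≤m+n _ y) l'
  -- The window consists of the last d entries of A and the first e of B.
  case₃ : ∀ d e → a + d ≡ cA → a + z ≡ cA + e → z ≡ d + e → e ≤ cB → QW z ≤ QA d + PB e →
          PW a + QW z ≤ PW (a + z)
  case₃ d e ad≡ az≡ z≡ e≤ l = lin (PW a ∷ PA a ∷ QW z ∷ QA d ∷ PB e ∷ TA ∷ PW (a + z) ∷ [])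
    (λ p p' q qd pe t r → p :≡ p' ⇒ q :≤ qd :+ pe ⇒ p' :+ qd :≡ t ⇒ t :+ pe :≡ r ⇒ goal (p :+ q) r)
    (P-left u v (≤-trans (m≤m+n a d) (≤-reflexive ad≡))) l (P+Q (suc u) v a d ad≡) (sym (P-right u v e az≡))
  case₄ : ∀ d e → z ≡ d + e → d ≤ cA → e ≤ cB → z ≤ cB ⊎ (∃ λ y → z ≡ cB + y) → QW z ≤ QA d + PB e
  case₄ d e refl d≤ e≤ (inj₁ z≤) = lin (QW z ∷ QB z ∷ QB d ∷ PB e ∷ QA d ∷ [])
    (λ q q' qd pe qa → q :≡ q' ⇒ q' :≤ qd :+ pe ⇒ qd :≤ qa ⇒ goal q (qa :+ pe))
    (Q-left u v z≤) (Q-subadditive u (suc v) subB d e z≤) (dq d d≤)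
  -- The last z entries of W are all of B and the last y of A. Taking away the first e of B leaves
  -- the last g of B, and g + y = d; both ends are then collected at the end of A.
  case₄ d e z≡ d≤ e≤ (inj₂ (y , z≡')) with m≤n⇒∃[o]m+o≡n e≤
  ... | g , eg≡ = lin (QW z ∷ TB ∷ QA y ∷ PB e ∷ QB g ∷ QA g ∷ QA (g + y) ∷ QA d ∷ [])
    (λ q tb qy pe qg qg' s qd → q :≡ tb :+ qy ⇒ tb :≡ pe :+ qg ⇒ qg :≤ qg' ⇒ qg' :+ qy :≤ s ⇒ s :≡ qd ⇒
       goal q (qd :+ pe))
    (Q-right u v y z≡') (sym (P+Q u (suc v) e g eg≡)) (dq g (≤-trans (m≤m+n g y) gy≤))
    (Q-superadditive (suc u) v sufA g y gy≤) (cong QA gy≡)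
    where
    gy≡ : g + y ≡ d
    gy≡ = +-cancelʳ-≡ e _ _ (≤-antisym
      (lin (g ∷ y ∷ e ∷ d ∷ z ∷ cB ∷ []) (λ g y e d z b → e :+ g :≡ b ⇒ b :+ y :≡ z ⇒ z :≡ d :+ e ⇒ goal (g :+ y :+ e) (d :+ e)) eg≡ (sym z≡') z≡)
      (lin (g ∷ y ∷ e ∷ d ∷ z ∷ cB ∷ []) (λ g y e d z b → b :≡ e :+ g ⇒ z :≡ b :+ y ⇒ d :+ e :≡ z ⇒ goal (d :+ e) (g :+ y :+ e)) (sym eg≡) z≡' (sym z≡)))
    gy≤ : g + y ≤ cA
    gy≤ = ≤-trans (≤-reflexive gy≡) d≤
  go : a + z ≤ cA ⊎ (∃ λ y → a + z ≡ cA + y) → z ≤ cB ⊎ (∃ λ y → z ≡ cB + y) →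
       a ≤ cA ⊎ (∃ λ y → a ≡ cA + y) → PW a + QW z ≤ PW (a + z)
  go (inj₁ l) s _ = case₁ l s
  go (inj₂ (e , az≡)) s (inj₁ a≤) with m≤n⇒∃[o]m+o≡n a≤
  ... | d , ad≡ = case₃ d e ad≡ az≡ z≡ e≤ (case₄ d e z≡ (≤-trans (m≤n+m d a) (≤-reflexive ad≡)) e≤ s)
    where
    z≡ : z ≡ d + e
    z≡ = +-cancelˡ-≡ a _ _ (trans az≡ (trans (cong (_+ e) (sym ad≡)) (+-assoc a d e)))
    e≤ : e ≤ cB
    e≤ = +-cancelˡ-≤ cA _ _ (≤-trans (≤-reflexive (sym az≡)) h)
  go (inj₂ _) _ (inj₂ (y , refl)) = lin (PW a ∷ TA ∷ PB y ∷ QW z ∷ QB z ∷ PB (y + z) ∷ PW (a + z) ∷ [])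
    (λ p t py q q' s r → p :≡ t :+ py ⇒ q :≡ q' ⇒ py :+ q' :≤ s ⇒ t :+ s :≡ r ⇒ goal (p :+ q) r)
    (P-right u v y refl) (Q-left u v (≤-trans (m≤n+m z y) yz≤)) (sufB y z yz≤)
    (sym (P-right u v (y + z) (+-assoc cA y z)))
    where
    yz≤ : y + z ≤ cB
    yz≤ = +-cancelˡ-≤ cA _ _ (≤-trans (≤-reflexive (sym (+-assoc cA y z))) h)

-- The critical case is a, b ≤ `cA` with a + b = `cA` + j: the j entries taken from B are exchanged
-- for the first j of A by `PrefixMonotone`, and together with the d entries of A after its first b
-- they are at most the first j + d = a entries of A, by `SuffixMinimal`.
subadditive-step : ∀ u v → Subadditive (suc u) v → Subadditive u (suc v) → SuffixMinimal (suc u) v → PrefixMonotone u v → Subadditive (suc u) (suc v)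
subadditive-step u v subA subB sufA dp a b = go (compare-+ (a + b) cA) (compare-+ a cA) (compare-+ b cA)
  where
  cA = c (suc u) v
  PA = P (suc u) v
  PB = P u (suc v)
  QA = Q (suc u) v
  PW = P (suc u) (suc v)
  TA = Tot (suc u) v
  PB≤PW : ∀ m → m ≤ cA ⊎ (∃ λ y → m ≡ cA + y) → PB m ≤ PW m
  PB≤PW m (inj₁ l) = ≤-trans (dp m l) (≤-reflexive (sym (P-left u v l)))
  PB≤PW m (inj₂ (y , refl)) = lin (PB m ∷ PB cA ∷ PB y ∷ PA cA ∷ TA ∷ PW m ∷ [])
    (λ p q s r t w → p :≤ q :+ s ⇒ q :≤ r ⇒ r :≡ t ⇒ t :+ s :≡ w ⇒ goal p w)
    (subB cA y) (dp cA ≤-refl) (P-sat (suc u) v ≤-refl) (sym (P-right u v y refl))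
  beyond : ∀ x y → PW (cA + x + y) ≤ PW (cA + x) + PW y
  beyond x y = lin (PW (cA + x + y) ∷ TA ∷ PB (x + y) ∷ PB x ∷ PB y ∷ PW (cA + x) ∷ PW y ∷ [])
    (λ w t s p q r r' → w :≡ t :+ s ⇒ s :≤ p :+ q ⇒ q :≤ r' ⇒ t :+ p :≡ r ⇒ goal w (r :+ r'))
    (P-right u v (x + y) (+-assoc cA x y)) (subB x y) (PB≤PW y (compare-+ y cA)) (sym (P-right u v x refl))
  go : a + b ≤ cA ⊎ (∃ λ y → a + b ≡ cA + y) → a ≤ cA ⊎ (∃ λ y → a ≡ cA + y) →
       b ≤ cA ⊎ (∃ λ y → b ≡ cA + y) → PW (a + b) ≤ PW a + PW b
  go (inj₁ l) _ _ = subst₂ _≤_ (sym (P-left u v l))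
    (sym (cong₂ _+_ (P-left u v (≤-trans (m≤m+n a b) l)) (P-left u v (≤-trans (m≤n+m b a) l)))) (subA a b)
  go (inj₂ _) (inj₂ (x , refl)) _ = beyond x b
  go (inj₂ _) _ (inj₂ (x , refl)) = subst₂ _≤_ (cong PW (+-comm _ a)) (+-comm (PW (cA + x)) _) (beyond x a)
  go (inj₂ (j , ab≡)) (inj₁ a≤) (inj₁ b≤) with m≤n⇒∃[o]m+o≡n b≤
  ... | d , bd≡ = lin (PW (a + b) ∷ TA ∷ PB j ∷ PA j ∷ QA d ∷ PA (j + d) ∷ PA b ∷ PW a ∷ PW b ∷ [])
    (λ w t pj qj qd s pb wa wb → w :≡ t :+ pj ⇒ pj :≤ qj ⇒ qj :+ qd :≤ s ⇒ s :≡ wa ⇒ t :≡ pb :+ qd ⇒ pb :≡ wb ⇒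
       goal w (wa :+ wb))
    (P-right u v j ab≡) (dp j (≤-trans (m≤m+n j d) jd≤)) (sufA j d jd≤)
    (trans (cong PA jd≡) (sym (P-left u v a≤))) (sym (P+Q (suc u) v b d bd≡)) (sym (P-left u v b≤))
    where
    arrange : ∀ b d j → b + d + j ≡ j + d + b
    arrange = solve-∀
    jd≡ : j + d ≡ a
    jd≡ = +-cancelʳ-≡ b _ _ (sym (trans ab≡ (trans (cong (_+ j) (sym bd≡)) (arrange b d j))))
    jd≤ : j + d ≤ cA
    jd≤ = ≤-trans (≤-reflexive jd≡) a≤

cancel-complement : ∀ {m n w g y} → w + g ≡ m → m + y ≡ n + w → g + y ≡ n
cancel-complement {m} {n} {w} {g} {y} p q = +-cancelˡ-≡ w _ _
  (trans (sym (+-assoc w g y)) (trans (cong (_+ y) p) (trans q (+-comm n w))))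

-- The two lists to be compared share a block: the one for (u + 1, v + 2) is M followed by B, the
-- one for (u + 2, v + 1) is A followed by M.
module _ (u v : ℕ) where
  private
    cA = c (2 + u) v
    cM = c (suc u) (suc v)
    cB = c u (2 + v)
    PA = P (2 + u) v
    PM = P (suc u) (suc v)
    PB = P u (2 + v)
    QA = Q (2 + u) v
    QM = Q (suc u) (suc v)
    QB = Q u (2 + v)
    TA = Tot (2 + u) v
    TM = Tot (suc u) (suc v)
    TB = Tot u (2 + v)

  -- B is compared with A by way of M, which requires z ≤ `cM`. For z ≤ `cB` this is unimodality;
  -- for larger z the sum over B is already saturated and z can be replaced by `cB`.
  monotone-two-steps : (F G H : ℕ → ℕ) → (∀ {m} → cB ≤ m → F m ≡ TB) → (∀ {m n} → m ≤ n → H m ≤ H n) →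
         (∀ z → z ≤ cM → F z ≤ G z) → (∀ z → z ≤ cA → G z ≤ H z) →
         ∀ z → z ≤ cA → F z ≤ H z
  monotone-two-steps F G H sat mono FG GH z z≤ with ≤-total z cB
  ... | inj₁ l = ≤-trans (FG z (c-unimodal u v l z≤)) (GH z z≤)
  ... | inj₂ l = ≤-trans (≤-reflexive (trans (sat l) (sym (sat ≤-refl))))
                   (≤-trans (FG cB (c-unimodal u v ≤-refl cB≤)) (≤-trans (GH cB cB≤) (mono l)))
    where
    cB≤ : cB ≤ cA
    cB≤ = ≤-trans l z≤

  module _ (dqM : SuffixMonotone (suc u) v) (dpB : PrefixMonotone u (suc v)) where

    suffixMonotone-step : SuffixMinimal (suc u) (suc v) → Subadditive u (2 + v) → SuffixMonotone u (suc v) → SuffixMonotone (suc u) (suc v)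
    suffixMonotone-step sufM subB dqB z h = go (compare-+ z cM) (compare-+ z cB)
      where
      QW = Q (suc u) (2 + v)
      QX = Q (2 + u) (suc v)
      QB≤QA : ∀ y → y ≤ cA → QB y ≤ QA y
      QB≤QA = monotone-two-steps QB QM QA (Q-sat u (2 + v)) (Q-mono (2 + u) v) dqB dqM
      go : z ≤ cM ⊎ (∃ λ y → z ≡ cM + y) → z ≤ cB ⊎ (∃ λ y → z ≡ cB + y) → QW z ≤ QX z
      go (inj₁ l) (inj₁ l') = ≤-trans (≤-reflexive (Q-left u (suc v) l'))
        (≤-trans (dqB z l) (≤-reflexive (sym (Q-left (suc u) v l))))
      go (inj₁ l) (inj₂ (y , refl)) = lin (QW z ∷ TB ∷ QM y ∷ QB cB ∷ QM cB ∷ QM z ∷ QX z ∷ [])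
        (λ w t m b b' s x → w :≡ t :+ m ⇒ t :≡ b ⇒ b :≤ b' ⇒ b' :+ m :≤ s ⇒ s :≡ x ⇒ goal w x)
        (Q-right u (suc v) y refl) (sym (Q-sat u (2 + v) ≤-refl)) (dqB cB (≤-trans (m≤m+n _ y) l))
        (Q-superadditive (suc u) (suc v) sufM cB y l) (sym (Q-left (suc u) v l))
      go (inj₂ (y , refl)) (inj₁ l) = lin (QW z ∷ QB z ∷ QB y ∷ PB cM ∷ PM cM ∷ TM ∷ QA y ∷ QX z ∷ [])
        (λ w b b' p p' t a x → w :≡ b ⇒ b :≤ b' :+ p ⇒ p :≤ p' ⇒ p' :≡ t ⇒ b' :≤ a ⇒ t :+ a :≡ x ⇒ goal w x)
        (Q-left u (suc v) l)
        (subst (λ m → QB m ≤ QB y + PB cM) (+-comm y cM) (Q-subadditive u (2 + v) subB y cM (≤-trans (≤-reflexive (+-comm y cM)) l)))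
        (dpB cM ≤-refl) (P-sat (suc u) (suc v) ≤-refl) (QB≤QA y y≤) (sym (Q-right (suc u) v y refl))
        where
        y≤ : y ≤ cA
        y≤ = +-cancelˡ-≤ cM _ _ (≤-trans h (≤-reflexive (+-comm cA cM)))
      go (inj₂ (y , refl)) (inj₂ (w , z≡)) = either (compare-+ w cM)
        where
        y≤ : y ≤ cA
        y≤ = +-cancelˡ-≤ cM _ _ (≤-trans h (≤-reflexive (+-comm cA cM)))
        either : w ≤ cM ⊎ (∃ λ x → w ≡ cM + x) → QW z ≤ QX z
        -- Since g + y = `cB`, the list B splits into its first g and its last y entries. The former
        -- are exchanged for the first g of M, which complete the last w to all of M; the latter for
        -- the last y of A.
        either (inj₁ w≤) with m≤n⇒∃[o]m+o≡n w≤
        ... | g , wg≡ = lin (QW z ∷ TB ∷ QM w ∷ PB g ∷ QB y ∷ PM g ∷ TM ∷ QA y ∷ QX z ∷ [])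
          (λ q t m p b p' t' a x → q :≡ t :+ m ⇒ t :≡ p :+ b ⇒ p :≤ p' ⇒ p' :+ m :≡ t' ⇒ b :≤ a ⇒ t' :+ a :≡ x ⇒ goal q x)
          (Q-right u (suc v) w z≡) (sym (P+Q u (2 + v) g y (cancel-complement wg≡ z≡)))
          (dpB g (≤-trans (m≤n+m g w) (≤-reflexive wg≡)))
          (P+Q (suc u) (suc v) g w (trans (+-comm g w) wg≡)) (QB≤QA y y≤) (sym (Q-right (suc u) v y refl))
        either (inj₂ (x , refl)) = lin (QW z ∷ TB ∷ QM w ∷ TM ∷ QB y ∷ QA y ∷ QX z ∷ [])
          (λ q t m t' b a r → q :≡ t :+ m ⇒ m :≡ t' ⇒ t :≡ b ⇒ b :≤ a ⇒ t' :+ a :≡ r ⇒ goal q r)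
          (Q-right u (suc v) w z≡) (Q-sat (suc u) (suc v) (m≤m+n cM x)) (sym (Q-sat u (2 + v) cB≤y)) (QB≤QA y y≤)
          (sym (Q-right (suc u) v y refl))
          where
          arrange : ∀ a b x → a + (b + x) ≡ b + (a + x)
          arrange = solve-∀
          cB≤y : cB ≤ y
          cB≤y = ≤-trans (m≤m+n cB x) (≤-reflexive (sym (+-cancelˡ-≡ cM _ _ (trans z≡ (arrange cB cM x)))))

    prefixMonotone-step : SuffixMinimal (2 + u) v → Subadditive (suc u) (suc v) → PrefixMonotone (suc u) v → PrefixMonotone (suc u) (suc v)
    prefixMonotone-step sufA subM dpM b h = go (compare-+ b cM) (compare-+ b cA)
      where
      PW = P (suc u) (2 + v)
      PX = P (2 + u) (suc v)
      PB≤PA : ∀ y → y ≤ cA → PB y ≤ PA y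
      PB≤PA = monotone-two-steps PB PM PA (P-sat u (2 + v)) (P-mono (2 + u) v) dpB dpM
      go : b ≤ cM ⊎ (∃ λ y → b ≡ cM + y) → b ≤ cA ⊎ (∃ λ y → b ≡ cA + y) → PW b ≤ PX b
      go (inj₁ l) (inj₁ l') = ≤-trans (≤-reflexive (P-left u (suc v) l))
        (≤-trans (dpM b l') (≤-reflexive (sym (P-left (suc u) v l'))))
      go (inj₁ l) (inj₂ (y , refl)) = lin (PW b ∷ PM b ∷ PM cA ∷ PM y ∷ PA cA ∷ TA ∷ PX b ∷ [])
        (λ w m p q a t x → w :≡ m ⇒ m :≤ p :+ q ⇒ p :≤ a ⇒ a :≡ t ⇒ t :+ q :≡ x ⇒ goal w x)
        (P-left u (suc v) l) (subM cA y) (dpM cA ≤-refl) (P-sat (2 + u) v ≤-refl) (sym (P-right (suc u) v y refl))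
      go (inj₂ (y , refl)) (inj₁ l) = lin (PW b ∷ TM ∷ PB y ∷ PA y ∷ QM cM ∷ QA cM ∷ PA b ∷ PX b ∷ [])
        (λ w t p a q q' s x → w :≡ t :+ p ⇒ t :≡ q ⇒ q :≤ q' ⇒ p :≤ a ⇒ a :+ q' :≤ s ⇒ s :≡ x ⇒ goal w x)
        (P-right u (suc v) y refl) (sym (Q-sat (suc u) (suc v) ≤-refl)) (dqM cM (≤-trans (m≤m+n cM y) l))
        (PB≤PA y (≤-trans (m≤n+m y cM) l))
        (subst (λ m → PA y + QA cM ≤ PA m) (+-comm y cM) (sufA y cM (≤-trans (≤-reflexive (+-comm y cM)) l)))
        (sym (P-left (suc u) v l))
      go (inj₂ (y , refl)) (inj₂ (w , b≡)) with m≤n⇒∃[o]m+o≡n w≤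
        where
        w≤ : w ≤ cM
        w≤ = +-cancelˡ-≤ cA _ _ (≤-trans (≤-reflexive (sym b≡)) h)
      ... | g , wg≡ = lin (PW b ∷ TM ∷ PB y ∷ PM w ∷ QM g ∷ QA g ∷ PA y ∷ TA ∷ PX b ∷ [])
        (λ q t p m r r' a t' x → q :≡ t :+ p ⇒ t :≡ m :+ r ⇒ r :≤ r' ⇒ p :≤ a ⇒ a :+ r' :≡ t' ⇒ t' :+ m :≡ x ⇒ goal q x)
        (P-right u (suc v) y refl) (sym (P+Q (suc u) (suc v) w g wg≡)) (dqM g (≤-trans (m≤m+n g y) (≤-reflexive gy≡)))
        (PB≤PA y (≤-trans (m≤n+m y g) (≤-reflexive gy≡)))
        (P+Q (2 + u) v y g (trans (+-comm y g) gy≡)) (sym (P-right (suc u) v w b≡))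
        where
        gy≡ : g + y ≡ cA
        gy≡ = cancel-complement wg≡ b≡

record Inequalities (N : ℕ) : Set where
  field
    suf : ∀ u v → u + v ≡ N → SuffixMinimal u v
    sub : ∀ u v → u + v ≡ N → Subadditive u v
    dq : ∀ u v → u + suc v ≡ N → SuffixMonotone u v
    dp : ∀ u v → u + suc v ≡ N → PrefixMonotone u v

suffixMinimal-nil : ∀ u → SuffixMinimal u 0
suffixMinimal-nil zero a z l = z≤n
suffixMinimal-nil (suc u) zero z l = ≤-reflexive (Q≡P z)
  where
  Q≡P : ∀ z → Q (suc u) 0 z ≡ P (suc u) 0 z
  Q≡P zero = refl
  Q≡P (suc z) = refl
suffixMinimal-nil (suc u) (suc zero) zero l = ≤-reflexive (+-identityʳ _)
suffixMinimal-nil (suc u) (suc zero) (suc z) (s≤s ())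
suffixMinimal-nil (suc u) (suc (suc a)) z (s≤s ())

subadditive-nil : ∀ u → Subadditive u 0
subadditive-nil zero a b = z≤n
subadditive-nil (suc u) zero b = ≤-refl
subadditive-nil (suc u) (suc a) b = m≤m+n _ _

Q-one : ∀ u → Q u 1 1 ≡ 0
Q-one zero = refl
Q-one (suc u) rewrite c-oneʳ u | 0∸n≡0 u = trans (+-identityʳ _) (Q-one u)

P-one : ∀ u → P u 1 1 ≡ u
P-one zero = refl
P-one (suc u) rewrite P-zero u 1 = +-identityʳ (suc u)

suffixMonotone-nil : ∀ u → SuffixMonotone u 0
suffixMonotone-nil u zero l = ≤-reflexive (Q-zero u 1)
suffixMonotone-nil u (suc zero) l = ≤-trans (≤-reflexive (Q-one u)) z≤n
suffixMonotone-nil u (suc (suc z)) (s≤s ())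

prefixMonotone-nil : ∀ u → PrefixMonotone u 0
prefixMonotone-nil u zero l = ≤-reflexive (P-zero u 1)
prefixMonotone-nil u (suc zero) l = ≤-trans (≤-reflexive (P-one u)) (n≤1+n u)
prefixMonotone-nil u (suc (suc z)) (s≤s ())

inequalities : ∀ N → Inequalities N
inequalities zero = record
  { suf = λ { zero zero _ → suffixMinimal-nil zero }
  ; sub = λ { zero zero _ → subadditive-nil zero }
  ; dq = λ { zero v () ; (suc u) v () }
  ; dp = λ { zero v () ; (suc u) v () } }
inequalities (suc N) = record { suf = suf' ; sub = sub' ; dq = dq' ; dp = dp' }
  where
  open Inequalities (inequalities N)
  right : ∀ {u v} → suc u + suc v ≡ suc N → u + suc v ≡ N
  right = suc-injective
  left : ∀ {u v} → suc u + suc v ≡ suc N → suc u + v ≡ N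
  left {u} {v} e = trans (sym (+-suc u v)) (suc-injective e)
  suf' : ∀ u v → u + v ≡ suc N → SuffixMinimal u v
  suf' zero v e a z l = z≤n
  suf' (suc u) zero e = suffixMinimal-nil (suc u)
  suf' (suc u) (suc v) e = suffixMinimal-step u v (suf (suc u) v (left e)) (suf u (suc v) (right e)) (sub u (suc v) (right e)) (dq u v (right e))
  sub' : ∀ u v → u + v ≡ suc N → Subadditive u v
  sub' zero v e a b = z≤n
  sub' (suc u) zero e = subadditive-nil (suc u)
  sub' (suc u) (suc v) e = subadditive-step u v (sub (suc u) v (left e)) (sub u (suc v) (right e)) (suf (suc u) v (left e)) (dp u v (right e))
  dq' : ∀ u v → u + suc v ≡ suc N → SuffixMonotone u v
  dq' zero v e z l = z≤n
  dq' (suc u) zero e = suffixMonotone-nil (suc u)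
  dq' (suc u) (suc v) e = suffixMonotone-step u v (dq _ _ (left e)) (dp _ _ (right e))
    (suf (suc u) (suc v) (left e)) (sub u (2 + v) (right e)) (dq _ _ (right e))
  dp' : ∀ u v → u + suc v ≡ suc N → PrefixMonotone u v
  dp' zero v e z l = z≤n
  dp' (suc u) zero e = prefixMonotone-nil (suc u)
  dp' (suc u) (suc v) e = prefixMonotone-step u v (dq _ _ (left e)) (dp _ _ (right e))
    (suf (2 + u) v (trans (sym (+-suc (suc u) v)) (left e))) (sub (suc u) (suc v) (left e)) (dp _ _ (left e))

P-suffixMinimal : ∀ u v → SuffixMinimal u v
P-suffixMinimal u v = Inequalities.suf (inequalities (u + v)) u v refl

P-subadditive : ∀ u v → Subadditive u v
P-subadditive u v = Inequalities.sub (inequalities (u + v)) u v refl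

-- Numerical form of the double count between levels v and v + 1 of a (u + v)-set: a v-set has u
-- supersets and a (v + 1)-set has v + 1 subsets on the other level. In the second half of the list,
-- the first half contributes with equality by `c-absorb`, and y ≤ `cB` pays for the change of both
-- factors.
P-LYM : ∀ u v m → m ≤ c u v → u * m ≤ suc v * P u v m
P-LYM zero v m l = z≤n
P-LYM (suc u) zero zero l = ≤-reflexive (*-zeroʳ u)
P-LYM (suc u) zero (suc zero) l = ≤-reflexive (trans (*-identityʳ (suc u)) (sym (+-identityʳ (suc u))))
P-LYM (suc u) zero (suc (suc m)) (s≤s ())
P-LYM (suc u) (suc v) m l with compare-+ m (c (suc u) v)
... | inj₁ l' = ≤-trans (P-LYM (suc u) v m l')
      (*-mono-≤ (n≤1+n (suc v)) (≤-reflexive (sym (P-left u v l'))))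
... | inj₂ (y , refl) = ≤-trans
      (lin (suc u * (cA + y) ∷ suc u * cA ∷ u * y ∷ y ∷ suc v * cB ∷ (2 + v) * P u (suc v) y ∷ cB ∷ (2 + v) * (cB + P u (suc v) y) ∷ [])
        (λ s a q y b p cb r → s :≡ a :+ q :+ y ⇒ a :≡ b ⇒ q :≤ p ⇒ y :≤ cb ⇒ b :+ cb :+ p :≡ r ⇒ goal s r)
        (expand₁ u cA y) (c-absorb u v) (P-LYM u (suc v) y y≤) y≤ (expand₂ v cB (P u (suc v) y)))
      (≤-reflexive (cong ((2 + v) *_) (sym (P-right u v y refl))))
  where
  cA = c (suc u) v
  cB = c u (suc v)
  y≤ : y ≤ cB
  y≤ = +-cancelˡ-≤ cA _ _ l
  expand₁ : ∀ u a y → suc u * (a + y) ≡ suc u * a + u * y + y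
  expand₁ = solve-∀
  expand₂ : ∀ v b p → suc v * b + b + (2 + v) * p ≡ (2 + v) * (b + p)
  expand₂ = solve-∀

P-one-pos : ∀ v m → P 1 v (suc m) ≡ 1
P-one-pos zero m = refl
P-one-pos (suc v) m = trans (+-identityʳ _) (P-one-pos v m)

P-one-step : ∀ u b → P (suc u) 1 b ≤ b + P u 1 b
P-one-step u zero = ≤-trans (≤-reflexive (P-zero (suc u) 1)) z≤n
P-one-step zero (suc b) = ≤-trans (≤-reflexive (P-one-pos 1 b)) (s≤s z≤n)
P-one-step (suc u) (suc b) = lin (P (suc u) 1 b ∷ P u 1 b ∷ b ∷ u ∷ [])
  (λ p q b u → p :≤ b :+ q ⇒ goal (lit 2 :+ u :+ p) (lit 1 :+ b :+ (lit 1 :+ u :+ q))) (P-one-step u b)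

-- The inequality of Eckhoff and Wegner,
--   s_r(a + b) ≤ max (s_r(a), b) + s_{r-1}(b),
-- to which the induction step of the Kruskal–Katona theorem reduces.
P-split : ∀ u v a b → a ≤ c (suc u) v → b ≤ c u (suc v) →
          P (suc u) (suc v) (a + b) ≤ P (suc u) v a + P u (suc v) b ⊎
          P (suc u) (suc v) (a + b) ≤ b + P u (suc v) b
P-split zero v zero zero _ _ = inj₂ (≤-reflexive (P-zero 1 (suc v)))
P-split zero v zero (suc b) _ _ = inj₂ (≤-trans (≤-reflexive (P-one-pos (suc v) b)) (s≤s z≤n))
P-split zero v (suc a) b _ _ = inj₁ (≤-reflexive
  (trans (P-one-pos (suc v) (a + b)) (sym (trans (+-identityʳ _) (P-one-pos v a)))))
P-split (suc u) zero zero b _ _ = inj₂ (P-one-step (suc u) b)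
P-split (suc u) zero (suc zero) b _ _ = inj₁ ≤-refl
P-split (suc u) zero (suc (suc a)) b (s≤s ()) _
P-split (suc u) (suc v) a b a≤ b≤ = go (compare-+ (a + b) cA)
  where
  cA' = c (2 + u) v
  cM = c (suc u) (suc v)
  cB″ = c u (2 + v)
  cA = c (2 + u) (suc v)
  cB = c (suc u) (2 + v)
  PA' = P (2 + u) v
  PM = P (suc u) (suc v)
  PB″ = P u (2 + v)
  PA = P (2 + u) (suc v)
  PB = P (suc u) (2 + v)
  PW = P (2 + u) (2 + v)
  QA = Q (2 + u) (suc v)
  QM = Q (suc u) (suc v)
  TA' = Tot (2 + u) v
  Goal = PW (a + b) ≤ PA a + PB b ⊎ PW (a + b) ≤ b + PB b

  below : a + b ≤ cA → b ≤ cM ⊎ (∃ λ y → b ≡ cM + y) → a ≤ cA' ⊎ (∃ λ y → a ≡ cA' + y) → Goal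
  below l (inj₁ b≤M) (inj₁ a≤A') with P-split (suc u) v a b a≤A' b≤M
  ... | inj₁ p = inj₁ (subst₂ _≤_ (sym (P-left (suc u) (suc v) l))
          (sym (cong₂ _+_ (P-left (suc u) v a≤A') (P-left u (suc v) b≤M))) p)
  ... | inj₂ p = inj₂ (subst₂ _≤_ (sym (P-left (suc u) (suc v) l))
          (sym (cong (b +_) (P-left u (suc v) b≤M))) p)
  below l (inj₁ b≤M) (inj₂ (y , refl)) = inj₁ (lin
    (PW (a + b) ∷ PA (a + b) ∷ TA' ∷ PM (y + b) ∷ PM y ∷ PM b ∷ PA a ∷ PB b ∷ [])
    (λ w p t s q r x z → w :≡ p ⇒ p :≡ t :+ s ⇒ s :≤ q :+ r ⇒ t :+ q :≡ x ⇒ r :≡ z ⇒ goal w (x :+ z))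
    (P-left (suc u) (suc v) l) (P-right (suc u) v (y + b) (+-assoc cA' y b)) (P-subadditive (suc u) (suc v) y b)
    (sym (P-right (suc u) v y refl)) (sym (P-left u (suc v) b≤M)))
  below l (inj₂ (y , refl)) _ = inj₂ (lin
    (PW (a + b) ∷ PA (a + b) ∷ PA cA ∷ cM ∷ cB″ ∷ PB″ y ∷ PB b ∷ y ∷ [])
    (λ w p t m s q r y → w :≡ p ⇒ p :≤ t ⇒ t :≡ m :+ s ⇒ s :+ q :≡ r ⇒ goal w (m :+ y :+ r))
    (P-left (suc u) (suc v) l) (P-mono (2 + u) (suc v) l) (P-sat (2 + u) (suc v) ≤-refl)
    (sym (P-right u (suc v) y refl)))

  -- Here k is the room that a leaves in A and d the overflow into B. Since A is A' followed by M
  -- and B is M followed by B″, the end of A and the beginning of B are the same list M; this is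
  -- what makes `first` and `second` provable.
  module Above (k d : ℕ) (ab≡ : a + b ≡ cA + d) (ak≡ : a + k ≡ cA) (b≡ : b ≡ d + k) where

    first : QA k + PB d ≤ PB b → Goal
    first h = inj₁ (lin (PW (a + b) ∷ cB ∷ PB d ∷ PA a ∷ QA k ∷ PB b ∷ [])
      (λ w t p x q r → w :≡ t :+ p ⇒ t :≡ x :+ q ⇒ q :+ p :≤ r ⇒ goal w (x :+ r))
      (P-right (suc u) (suc v) d ab≡) (sym (P+Q (2 + u) (suc v) a k ak≡)) h)

    second : cB + PB d ≤ b + PB b → Goal
    second h = inj₂ (≤-trans (≤-reflexive (P-right (suc u) (suc v) d ab≡)) h)

    within : b ≤ cM → Goal
    within l = first (lin (QA k ∷ PB d ∷ PM d ∷ QM k ∷ PM (d + k) ∷ PB b ∷ [])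
      (λ q p p' q' s r → q :≡ q' ⇒ p :≡ p' ⇒ p' :+ q' :≤ s ⇒ s :≡ r ⇒ goal (q :+ p) r)
      (Q-left (suc u) v (≤-trans (m≤n+m k d) dk≤)) (P-left u (suc v) (≤-trans (m≤m+n d k) dk≤))
      (P-suffixMinimal (suc u) (suc v) d k dk≤)
      (trans (cong PM (sym b≡)) (sym (P-left u (suc v) l))))
      where
      dk≤ : d + k ≤ cM
      dk≤ = ≤-trans (≤-reflexive (sym b≡)) l

    beyond : ∀ d' → d ≡ cM + d' → k ≤ cM ⊎ (∃ λ y → k ≡ cM + y) → Goal
    beyond d' d≡ s = split s
      where
      b≡' : b ≡ cM + (d' + k)
      b≡' = trans b≡ (trans (cong (_+ k) d≡) (+-assoc cM d' k))
      dk≤ : d' + k ≤ cB″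
      dk≤ = +-cancelˡ-≤ cM _ _ (≤-trans (≤-reflexive (sym b≡')) b≤)
      split : k ≤ cM ⊎ (∃ λ y → k ≡ cM + y) → Goal
      split (inj₁ k≤) with m≤n⇒∃[o]m+o≡n k≤
      ... | e , ke≡ with P-split u (suc v) e (d' + k) (≤-trans (m≤n+m e k) (≤-reflexive ke≡)) dk≤
      ... | inj₁ p = first (lin
            (QA k ∷ QM k ∷ PB d ∷ PB (e + (d' + k)) ∷ PM e ∷ PB″ (d' + k) ∷ cB″ ∷ PB b ∷ [])
            (λ q q' p p' m r t s → q :≡ q' ⇒ p :≡ p' ⇒ p' :≤ m :+ r ⇒ m :+ q' :≡ t ⇒ t :+ r :≡ s ⇒ goal (q :+ p) s)
            (Q-left (suc u) v k≤) (cong PB (trans d≡ (trans (cong (_+ d') (sym ke≡)) (arrange k e d'))))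
            p (P+Q (suc u) (suc v) e k (trans (+-comm e k) ke≡)) (sym (P-right u (suc v) (d' + k) b≡')))
        where
        arrange : ∀ k e d → k + e + d ≡ e + (d + k)
        arrange = solve-∀
      ... | inj₂ p = second (lin
            (PB d ∷ PB (e + (d' + k)) ∷ PB″ (d' + k) ∷ cB″ ∷ PB b ∷ cM ∷ d' ∷ k ∷ b ∷ [])
            (λ p p' r t s m d k b → p :≡ p' ⇒ p' :≤ d :+ k :+ r ⇒ t :+ r :≡ s ⇒ m :+ (d :+ k) :≡ b ⇒ goal (m :+ t :+ p) (b :+ s))
            (cong PB (trans d≡ (trans (cong (_+ d') (sym ke≡)) (arrange k e d'))))
            p (sym (P-right u (suc v) (d' + k) b≡')) (sym b≡'))
        where
        arrange : ∀ k e d → k + e + d ≡ e + (d + k)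
        arrange = solve-∀
      split (inj₂ (y , refl)) with P-split u (suc v) 0 (d' + k) z≤n dk≤
      ... | inj₁ p = second (lin
            (PB d ∷ PB (d' + k) ∷ PM 0 ∷ PB″ (d' + k) ∷ cB″ ∷ PB b ∷ cM ∷ d' ∷ k ∷ b ∷ [])
            (λ p p' z r t s m d k b → p :≤ p' ⇒ p' :≤ z :+ r ⇒ z :≡ lit 0 ⇒ t :+ r :≡ s ⇒ m :+ (d :+ k) :≡ b ⇒ goal (m :+ t :+ p) (b :+ s))
            (P-mono (suc u) (2 + v) d≤) p (P-zero (suc u) (suc v)) (sym (P-right u (suc v) (d' + k) b≡')) (sym b≡'))
        where
        d≤ : d ≤ d' + k
        d≤ = lin (d ∷ cM ∷ d' ∷ y ∷ []) (λ d m d' y → d :≡ m :+ d' ⇒ goal d (d' :+ (m :+ y))) d≡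
      ... | inj₂ p = second (lin
            (PB d ∷ PB (d' + k) ∷ PB″ (d' + k) ∷ cB″ ∷ PB b ∷ cM ∷ d' ∷ k ∷ b ∷ [])
            (λ p p' r t s m d k b → p :≤ p' ⇒ p' :≤ d :+ k :+ r ⇒ t :+ r :≡ s ⇒ m :+ (d :+ k) :≡ b ⇒ goal (m :+ t :+ p) (b :+ s))
            (P-mono (suc u) (2 + v) d≤) p (sym (P-right u (suc v) (d' + k) b≡')) (sym b≡'))
        where
        d≤ : d ≤ d' + k
        d≤ = lin (d ∷ cM ∷ d' ∷ y ∷ []) (λ d m d' y → d :≡ m :+ d' ⇒ goal d (d' :+ (m :+ y))) d≡

    -- The prefix of length b reaches g entries into B″ while d stays within M. If g ≤ d, the
    -- induction hypothesis for d = f + g decides the alternative: in the first, f + k = `cM`, so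
    -- the first f and the last k entries of M make up M.
    straddle : ∀ g → b ≡ cM + g → d ≤ cM → g ≤ d ⊎ (∃ λ y → g ≡ d + y) → Goal
    straddle g b≡' d≤ s = split s
      where
      g≤ : g ≤ cB″
      g≤ = +-cancelˡ-≤ cM _ _ (≤-trans (≤-reflexive (sym b≡')) b≤)
      conclude : PM d ≤ g + PB″ g → Goal
      conclude p = second (lin (PB d ∷ PM d ∷ PB″ g ∷ PB b ∷ cM ∷ cB″ ∷ g ∷ b ∷ [])
        (λ p p' q r m t g b → p :≡ p' ⇒ p' :≤ g :+ q ⇒ t :+ q :≡ r ⇒ m :+ g :≡ b ⇒ goal (m :+ t :+ p) (b :+ r))
        (P-left u (suc v) d≤) p (sym (P-right u (suc v) g b≡')) (sym b≡'))
      split : g ≤ d ⊎ (∃ λ y → g ≡ d + y) → Goal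
      split (inj₁ g≤d) with m≤n⇒∃[o]m+o≡n g≤d
      ... | f , gf≡ with P-split u (suc v) f g (≤-trans (≤-trans (m≤n+m f g) (≤-reflexive gf≡)) d≤) g≤
      ... | inj₂ p = conclude (≤-trans (≤-reflexive (trans (cong PM (sym fg≡)) (sym (P-left u (suc v) (≤-trans (≤-reflexive fg≡) d≤))))) p)
        where
        fg≡ : f + g ≡ d
        fg≡ = trans (+-comm f g) gf≡
      ... | inj₁ p = first (lin (QA k ∷ QM k ∷ PB d ∷ PB (f + g) ∷ PM f ∷ PB″ g ∷ cB″ ∷ PB b ∷ [])
            (λ q q' p p' m r t s → q :≡ q' ⇒ p :≡ p' ⇒ p' :≤ m :+ r ⇒ m :+ q' :≡ t ⇒ t :+ r :≡ s ⇒ goal (q :+ p) s)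
            (Q-left (suc u) v (≤-trans (m≤n+m k f) (≤-reflexive fk≡))) (cong PB (trans (sym gf≡) (+-comm g f))) p
            (P+Q (suc u) (suc v) f k fk≡) (sym (P-right u (suc v) g b≡')))
        where
        fk≡ : f + k ≡ cM
        fk≡ = +-cancelˡ-≡ g _ _ (trans (sym (+-assoc g f k)) (trans (cong (_+ k) gf≡) (trans (sym b≡) (trans b≡' (+-comm cM g)))))
      split (inj₂ (y , refl)) with P-split u (suc v) 0 d z≤n (≤-trans (m≤m+n d y) g≤)
      ... | inj₁ p = conclude (≤-trans (lin (PM d ∷ PB d ∷ PM 0 ∷ PB″ d ∷ PB″ g ∷ [])
              (λ p p' z q r → p :≡ p' ⇒ p' :≤ z :+ q ⇒ z :≡ lit 0 ⇒ q :≤ r ⇒ goal p r)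
              (sym (P-left u (suc v) d≤)) p (P-zero (suc u) (suc v)) (P-mono u (2 + v) (m≤m+n d y)))
              (m≤n+m _ g))
      ... | inj₂ p = conclude (≤-trans (≤-reflexive (sym (P-left u (suc v) d≤)))
              (≤-trans p (+-mono-≤ (m≤m+n d y) (P-mono u (2 + v) (m≤m+n d y)))))

    above : Goal
    above with compare-+ b cM | compare-+ d cM
    ... | inj₁ l | _ = within l
    ... | inj₂ _ | inj₂ (d' , d≡) = beyond d' d≡ (compare-+ k cM)
    ... | inj₂ (g , b≡') | inj₁ d≤ = straddle g b≡' d≤ (compare-+ g d)

  go : a + b ≤ cA ⊎ (∃ λ y → a + b ≡ cA + y) → Goal
  go (inj₁ l) = below l (compare-+ b cM) (compare-+ a cA')
  go (inj₂ (d , ab≡)) with m≤n⇒∃[o]m+o≡n a≤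
  ... | k , ak≡ = Above.above k d ab≡ ak≡
    (+-cancelˡ-≡ a _ _ (trans ab≡ (trans (cong (_+ d) (sym ak≡)) (trans (+-assoc a k d) (cong (a +_) (+-comm k d))))))

-- The greedy binomial representation

c≡C : ∀ u v → c u v ≡ (u + v) C u
c≡C zero v = refl
c≡C (suc u) zero rewrite +-identityʳ u = sym (nCn≡1 (suc u))
c≡C (suc u) (suc v) = trans (+-comm (c (suc u) v) _) (trans
  (cong₂ _+_ (c≡C u (suc v)) (trans (c≡C (suc u) v) (cong (_C suc u) (sym (+-suc u v)))))
  (nCk+nC[k+1]≡[n+1]C[k+1] (u + suc v) u))

C-monoˡ-≤ : ∀ r {m n} → m ≤ n → m C suc r ≤ n C suc r
C-monoˡ-≤ r {m} m≤n with m≤n⇒∃[o]m+o≡n m≤n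
... | o , refl = grow o
  where
  grow : ∀ o → m C suc r ≤ (m + o) C suc r
  grow zero rewrite +-identityʳ m = ≤-refl
  grow (suc o) rewrite +-suc m o = ≤-trans (grow o)
    (≤-trans (m≤n+m _ _) (≤-reflexive (nCk+nC[k+1]≡[n+1]C[k+1] (m + o) r)))

topA-unique : ∀ r m b a → a ≤ b → a C suc r ≤ m → m < suc a C suc r → topA (suc r) m b ≡ a
topA-unique r m zero zero _ _ _ = refl
topA-unique r m (suc b) a a≤ l g with (suc b C suc r) ≤ᵇ m in eq | m≤n⇒m<n∨m≡n a≤
... | true  | inj₂ refl = refl
... | true  | inj₁ a<b = contradiction
  (≤-trans (≤-trans g (C-monoˡ-≤ r a<b)) (≤ᵇ⇒≤ _ m (subst T (sym eq) _))) (<-irrefl refl)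
... | false | inj₂ refl = contradiction (subst T eq (≤⇒≤ᵇ l)) λ ()
... | false | inj₁ (s≤s a≤b) = topA-unique r m b a a≤b l g

-- This ensures that the search bound in `shadowSum` is large enough to reach the greedy
-- coefficient.
c-lower : ∀ r v → suc v ≤ c (suc r) v
c-lower r zero = s≤s z≤n
c-lower r (suc v) = ≤-trans (≤-reflexive (+-comm 1 (suc v))) (+-mono-≤ (c-lower r v) (c>0 r (suc v)))

shadowSum-zero : ∀ r → shadowSum r 0 ≡ 0
shadowSum-zero zero = refl
shadowSum-zero (suc r) = refl

shadowSum-step : ∀ r v m → c (suc r) v ≤ suc m → suc m < c (suc r) (suc v) →
                 shadowSum (suc r) (suc m) ≡ c r (suc v) + shadowSum r (suc m ∸ c (suc r) v)
shadowSum-step r v m l g rewrite topA-unique r (suc m) (suc m + suc r) (suc r + v)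
    (≤-trans (≤-reflexive (+-comm (suc r) v)) (+-monoˡ-≤ (suc r) (≤-trans (n≤1+n v) (≤-trans (c-lower r v) l))))
    (≤-trans (≤-reflexive (sym (c≡C (suc r) v))) l)
    (≤-trans g (≤-reflexive (trans (c≡C (suc r) (suc v)) (cong (λ n → suc n C suc r) (+-suc r v)))))
  | sym (c≡C (suc r) v) | sym (+-suc r v) | sym (c≡C r (suc v)) = refl

-- The leading binomial coefficient is the length of the largest initial block that fits into m
-- entries, and the remainder is a prefix of the block that follows; hence the greedy recursion is
-- that of `P`.
shadowSum≡P : ∀ r v m → m ≤ c r v → shadowSum r m ≡ P r v m
shadowSum≡P zero v m l = refl
shadowSum≡P (suc r) v zero l = sym (P-zero (suc r) v)
shadowSum≡P (suc r) v (suc m) l = go v l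
  where
  full : ∀ v → suc m ≡ c (suc r) v → shadowSum (suc r) (suc m) ≡ P (suc r) v (suc m)
  full v e = trans
    (shadowSum-step r v m (≤-reflexive (sym e))
      (≤-trans (≤-reflexive (trans (cong suc e) (+-comm 1 _))) (+-monoʳ-≤ (c (suc r) v) (c>0 r (suc v)))))
    (trans (cong (c r (suc v) +_) (trans (cong (shadowSum r) (m≤n⇒m∸n≡0 (≤-reflexive e))) (shadowSum-zero r)))
      (trans (+-identityʳ _) (sym (P-sat (suc r) v (≤-reflexive (sym e))))))
  go : ∀ v → suc m ≤ c (suc r) v → shadowSum (suc r) (suc m) ≡ P (suc r) v (suc m)
  go zero l = full zero (≤-antisym l (s≤s z≤n))
  go (suc v) l with m≤n⇒m<n∨m≡n l | ≤-total (suc m) (c (suc r) v)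
  ... | inj₂ e | _ = full (suc v) e
  ... | inj₁ g | inj₁ l' = trans (go v l') (sym (P-left r v l'))
  ... | inj₁ g | inj₂ l' = trans (shadowSum-step r v m l' g)
    (cong₂ _+_ (sym (P-sat (suc r) v l')) (shadowSum≡P r (suc v) (suc m ∸ c (suc r) v)
      (m≤n+o⇒m∸n≤o (suc m) (c (suc r) v) l)))

-- Counting families of sets

count-mono : (F? : Decidable F) (G? : Decidable G) → (∀ S → F S → G S) → count F? ≤ count G?
count-mono {zero} F? G? F⊆G with F? [] | G? []
... | yes p | yes q = ≤-refl
... | yes p | no ¬q = contradiction (F⊆G [] p) ¬q
... | no ¬p | _ = z≤n
count-mono {suc n} F? G? F⊆G = +-mono-≤
  (count-mono (F? ∘ (true ∷_)) (G? ∘ (true ∷_)) (F⊆G ∘ (true ∷_)))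
  (count-mono (F? ∘ (false ∷_)) (G? ∘ (false ∷_)) (F⊆G ∘ (false ∷_)))

count-cong : (F? : Decidable F) (G? : Decidable G) → (∀ S → F S → G S) → (∀ S → G S → F S) →
             count F? ≡ count G?
count-cong F? G? F⊆G G⊆F = ≤-antisym (count-mono F? G? F⊆G) (count-mono G? F? G⊆F)

count-∪ : (F? : Decidable F) (G? : Decidable G) (H? : Decidable H) → (∀ S → H S → F S ⊎ G S) →
          count H? ≤ count F? + count G?
count-∪ {zero} F? G? H? c with F? [] | G? [] | H? []
... | yes p | _ | yes r = s≤s z≤n
... | no ¬p | yes q | yes r = ≤-refl
... | no ¬p | no ¬q | yes r with c [] r
... | inj₁ p = contradiction p ¬p
... | inj₂ q = contradiction q ¬q
count-∪ {zero} F? G? H? c | _ | _ | no ¬r = z≤n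
count-∪ {suc n} F? G? H? c = lin
  (count (H? ∘ (true ∷_)) ∷ count (H? ∘ (false ∷_)) ∷ count (F? ∘ (true ∷_)) ∷ count (F? ∘ (false ∷_)) ∷
   count (G? ∘ (true ∷_)) ∷ count (G? ∘ (false ∷_)) ∷ [])
  (λ h h' f f' g g' → h :≤ f :+ g ⇒ h' :≤ f' :+ g' ⇒ goal (h :+ h') (f :+ f' :+ (g :+ g')))
  (count-∪ (F? ∘ (true ∷_)) (G? ∘ (true ∷_)) (H? ∘ (true ∷_)) (c ∘ (true ∷_)))
  (count-∪ (F? ∘ (false ∷_)) (G? ∘ (false ∷_)) (H? ∘ (false ∷_)) (c ∘ (false ∷_)))

count-∩ : (F? : Decidable F) (G? : Decidable G) (H? : Decidable H) (I? : Decidable (λ S → F S × G S)) →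
          (∀ S → F S → H S) → (∀ S → G S → H S) → count F? + count G? ≤ count H? + count I?
count-∩ {zero} F? G? H? I? f g with F? [] | G? [] | H? [] | I? []
... | no _ | no _ | _ | _ = z≤n
... | yes p | _ | no ¬r | _ = contradiction (f [] p) ¬r
... | _ | yes q | no ¬r | _ = contradiction (g [] q) ¬r
... | yes p | yes q | yes _ | yes _ = ≤-refl
... | yes p | yes q | yes _ | no ¬i = contradiction (p , q) ¬i
... | yes p | no _ | yes _ | _ = s≤s z≤n
... | no _ | yes q | yes _ | _ = s≤s z≤n
count-∩ {suc n} F? G? H? I? f g = lin
  (count (F? ∘ (true ∷_)) ∷ count (F? ∘ (false ∷_)) ∷ count (G? ∘ (true ∷_)) ∷ count (G? ∘ (false ∷_)) ∷
   count (H? ∘ (true ∷_)) ∷ count (H? ∘ (false ∷_)) ∷ count (I? ∘ (true ∷_)) ∷ count (I? ∘ (false ∷_)) ∷ [])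
  (λ f f' g g' h h' i i' → f :+ g :≤ h :+ i ⇒ f' :+ g' :≤ h' :+ i' ⇒
     goal (f :+ f' :+ (g :+ g')) (h :+ h' :+ (i :+ i')))
  (count-∩ (F? ∘ (true ∷_)) (G? ∘ (true ∷_)) (H? ∘ (true ∷_)) (I? ∘ (true ∷_)) (f ∘ (true ∷_)) (g ∘ (true ∷_)))
  (count-∩ (F? ∘ (false ∷_)) (G? ∘ (false ∷_)) (H? ∘ (false ∷_)) (I? ∘ (false ∷_)) (f ∘ (false ∷_)) (g ∘ (false ∷_)))

count-empty : (F? : Decidable F) → (∀ S → ¬ F S) → count F? ≡ 0
count-empty {zero} F? ¬F with F? []
... | yes p = contradiction p (¬F [])
... | no _ = refl
count-empty {suc n} F? ¬F = cong₂ _+_ (count-empty (F? ∘ (true ∷_)) (¬F ∘ (true ∷_)))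
                                      (count-empty (F? ∘ (false ∷_)) (¬F ∘ (false ∷_)))

count-⊎ : (F? : Decidable F) (G? : Decidable G) (H? : Decidable H) →
          (∀ S → F S → H S) → (∀ S → G S → H S) → (∀ S → F S → ¬ G S) → count F? + count G? ≤ count H?
count-⊎ F? G? H? f g dis = ≤-trans (count-∩ F? G? H? (λ S → F? S ×-dec G? S) f g)
  (≤-reflexive (trans (cong (count H? +_) (count-empty (λ S → F? S ×-dec G? S) (λ S (p , q) → dis S p q))) (+-identityʳ _)))

count-pos : (F? : Decidable F) → ∀ S → F S → 1 ≤ count F?
count-pos {zero} F? [] p with F? []
... | yes _ = ≤-refl
... | no ¬p = contradiction p ¬p
count-pos {suc n} F? (true ∷ S) p = ≤-trans (count-pos (F? ∘ (true ∷_)) S p) (m≤m+n _ _)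
count-pos {suc n} F? (false ∷ S) p = ≤-trans (count-pos (F? ∘ (false ∷_)) S p) (m≤n+m _ _)

count-full : (F? : Decidable F) (G? : Decidable G) → (∀ S → F S → G S) → count G? ≤ count F? →
             ∀ S → G S → F S
count-full {F = F} {G = G} F? G? F⊆G le S q with F? S
... | yes p = p
... | no ¬p = contradiction
  (≤-trans (≤-trans (+-monoʳ-≤ (count F?) (count-pos S≡? S refl))
    (count-⊎ F? S≡? G? F⊆G (λ { _ refl → q }) (λ { _ p refl → ¬p p }))) le)
  (λ l → <-irrefl refl (≤-trans (≤-reflexive (+-comm 1 _)) l))
  where
  S≡? : Decidable (S ≡_)
  S≡? = ≡-dec 𝔹._≟_ S

enum : (F? : Decidable F) → Fin (count F?) → ∃ F
enum {zero} F? i with F? []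
enum {zero} F? i | yes p = [] , p
enum {suc n} F? i with splitAt (count (F? ∘ (true ∷_))) i
... | inj₁ j = let (S , p) = enum (F? ∘ (true ∷_)) j in true ∷ S , p
... | inj₂ j = let (S , p) = enum (F? ∘ (false ∷_)) j in false ∷ S , p

enum-injective : (F? : Decidable F) → ∀ i j → proj₁ (enum F? i) ≡ proj₁ (enum F? j) → i ≡ j
enum-injective {zero} F? i j e with F? []
enum-injective {zero} F? Fin.zero Fin.zero e | yes p = refl
enum-injective {suc n} F? i j e with splitAt (count (F? ∘ (true ∷_))) i in eᵢ | splitAt (count (F? ∘ (true ∷_))) j in eⱼ
... | inj₁ x | inj₁ y = trans (sym (splitAt⁻¹-↑ˡ eᵢ))
  (trans (cong (_↑ˡ _) (enum-injective (F? ∘ (true ∷_)) x y (∷-injectiveʳ e))) (splitAt⁻¹-↑ˡ eⱼ))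
... | inj₂ x | inj₂ y = trans (sym (splitAt⁻¹-↑ʳ eᵢ))
  (trans (cong (count (F? ∘ (true ∷_)) ↑ʳ_) (enum-injective (F? ∘ (false ∷_)) x y (∷-injectiveʳ e))) (splitAt⁻¹-↑ʳ eⱼ))
enum-injective {suc n} F? i j () | inj₁ x | inj₂ y
enum-injective {suc n} F? i j () | inj₂ x | inj₁ y

index : (F? : Decidable F) → ∀ S → F S → Fin (count F?)
index {zero} F? [] p with F? []
... | yes _ = Fin.zero
... | no ¬p = contradiction p ¬p
index {suc n} F? (true ∷ S) p = index (F? ∘ (true ∷_)) S p ↑ˡ _
index {suc n} F? (false ∷ S) p = _ ↑ʳ index (F? ∘ (false ∷_)) S p

enum-index : (F? : Decidable F) → ∀ S p → proj₁ (enum F? (index F? S p)) ≡ S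
enum-index {zero} F? [] p with F? []
... | yes _ = refl
... | no ¬p = contradiction p ¬p
enum-index {suc n} F? (true ∷ S) p
  rewrite splitAt-↑ˡ (count (F? ∘ (true ∷_))) (index (F? ∘ (true ∷_)) S p) (count (F? ∘ (false ∷_))) =
  cong (true ∷_) (enum-index (F? ∘ (true ∷_)) S p)
enum-index {suc n} F? (false ∷ S) p
  rewrite splitAt-↑ʳ (count (F? ∘ (true ∷_))) (count (F? ∘ (false ∷_))) (index (F? ∘ (false ∷_)) S p) =
  cong (false ∷_) (enum-index (F? ∘ (false ∷_)) S p)

count≤-Fin : ∀ {k} (F? : Decidable F) (g : ∀ S → F S → Fin k) →
             (∀ S T p q → g S p ≡ g T q → S ≡ T) → count F? ≤ k
count≤-Fin F? g inj = injective⇒≤ {f = λ i → g _ (proj₂ (enum F? i))}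
  (λ {i} {j} e → enum-injective F? i j (inj _ _ _ _ e))

Fin≤-count : ∀ {k} (F? : Decidable F) (g : Fin k → Subset n) → (∀ i → F (g i)) →
             (∀ i j → g i ≡ g j → i ≡ j) → k ≤ count F?
Fin≤-count F? g Fg inj = injective⇒≤ {f = λ i → index F? (g i) (Fg i)}
  (λ {i} {j} e → inj i j (trans (sym (enum-index F? _ (Fg i)))
    (trans (cong (proj₁ ∘ enum F?) e) (enum-index F? _ (Fg j)))))

count-injection : (F? : Decidable F) (G? : Decidable G) (f : Subset n → Subset n) → (∀ S → F S → G (f S)) →
                  (∀ S T → F S → F T → f S ≡ f T → S ≡ T) → count F? ≤ count G?
count-injection F? G? f FG inj = Fin≤-count G? (f ∘ proj₁ ∘ enum F?) (λ i → FG _ (proj₂ (enum F? i)))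
  (λ i j e → enum-injective F? i j (inj _ _ (proj₂ (enum F? i)) (proj₂ (enum F? j)) e))

∁-involutive : (S : Subset n) → ∁ (∁ S) ≡ S
∁-involutive [] = refl
∁-involutive (x ∷ S) = cong₂ _∷_ (not-involutive x) (∁-involutive S)

count-∁ : (F? : Decidable F) → count (F? ∘ ∁) ≡ count F?
count-∁ {zero} F? with F? []
... | yes _ = refl
... | no _ = refl
count-∁ {suc n} F? = trans (+-comm (count (F? ∘ ∁ ∘ (true ∷_))) _)
  (cong₂ _+_ (count-∁ (F? ∘ (true ∷_))) (count-∁ (F? ∘ (false ∷_))))

count-∷ʳ : {F : Subset (suc n) → Set} (F? : Decidable F) →
           count F? ≡ count (F? ∘ (_∷ʳ true)) + count (F? ∘ (_∷ʳ false))
count-∷ʳ {zero} F? = cong₂ _+_ (count-cong (F? ∘ (true ∷_)) (F? ∘ (_∷ʳ true)) (λ { [] p → p }) (λ { [] p → p }))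
                               (count-cong (F? ∘ (false ∷_)) (F? ∘ (_∷ʳ false)) (λ { [] p → p }) (λ { [] p → p }))
count-∷ʳ {suc n} F? = trans (cong₂ _+_ (count-∷ʳ (F? ∘ (true ∷_))) (count-∷ʳ (F? ∘ (false ∷_))))
  (arrange (count (F? ∘ (true ∷_) ∘ (_∷ʳ true))) _ _ _)
  where
  arrange : ∀ a b c d → (a + b) + (c + d) ≡ (a + c) + (b + d)
  arrange = solve-∀

Rank? : ∀ r → Decidable (λ (S : Subset n) → ∣ S ∣ ≡ r)
Rank? r S = ∣ S ∣ ≟ r

count-Rank : ∀ u v {n} → u + v ≡ n → count {n} (Rank? v) ≡ c u v
count-Rank zero zero refl = refl
count-Rank (suc u) zero refl = cong₂ _+_ (count-empty {u + 0} (λ S → suc ∣ S ∣ ≟ 0) (λ S ()))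
  (trans (count-Rank u 0 refl) (c-zeroʳ u))
count-Rank zero (suc v) refl = trans
  (cong₂ _+_ (trans (count-cong {v} (λ S → suc ∣ S ∣ ≟ suc v) (Rank? v) (λ _ → suc-injective) (λ _ → cong suc)) (count-Rank zero v refl))
    (count-empty {v} (Rank? (suc v)) (λ S e → <-irrefl refl (≤-trans (≤-reflexive (sym e)) (∣p∣≤n S)))))
  refl
count-Rank (suc u) (suc v) refl = cong₂ _+_
  (trans (count-cong {u + suc v} (λ S → suc ∣ S ∣ ≟ suc v) (Rank? v) (λ _ → suc-injective) (λ _ → cong suc))
    (count-Rank (suc u) v (sym (+-suc u v))))
  (count-Rank u (suc v) refl)

-- Kruskal–Katona for the shade.  Splitting F by its first bit into F₁ and F₀,
-- the shade of F contains (F₀ ∪ ∇F₁) with that bit set and ∇F₀ without it.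
Kruskal–Katona : ∀ u v {n} (F : Subset n → Set) (F? : Decidable F) → u + v ≡ n → (∀ S → F S → ∣ S ∣ ≡ v) →
                 P u v (count F?) ≤ count (Shade? v F?)
Kruskal–Katona zero v F F? e r = z≤n
Kruskal–Katona (suc u) v {suc n} F F? e r = bound v e r
  where
  F₁ F₀ : Subset n → Set
  F₁ S = F (true ∷ S)
  F₀ S = F (false ∷ S)
  F₁? : Decidable F₁
  F₁? S = F? (true ∷ S)
  F₀? : Decidable F₀
  F₀? S = F? (false ∷ S)
  up₀ : ∀ v → (∀ S → F S → ∣ S ∣ ≡ v) → count F₀? ≤ count (Shade? v F? ∘ (true ∷_))
  up₀ v r = count-mono F₀? (Shade? v F? ∘ (true ∷_))
    (λ S p → cong suc (r _ p) , _ , p , out⊂in ⊆-refl)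
  up₁ : ∀ v → count (Shade? v F₁?) ≤ count (Shade? (suc v) F? ∘ (true ∷_))
  up₁ v = count-mono (Shade? v F₁?) (Shade? (suc v) F? ∘ (true ∷_))
    (λ { S (e , T , p , T⊂S) → cong suc e , _ , p , in⊂in T⊂S })
  down₀ : ∀ v → count (Shade? v F₀?) ≤ count (Shade? v F? ∘ (false ∷_))
  down₀ v = count-mono (Shade? v F₀?) (Shade? v F? ∘ (false ∷_))
    (λ { S (e , T , p , T⊂S) → e , _ , p , out⊂ T⊂S })
  bound : ∀ v → suc u + v ≡ suc n → (∀ S → F S → ∣ S ∣ ≡ v) → P (suc u) v (count F?) ≤ count (Shade? v F?)
  bound zero e r = ≤-trans (≤-reflexive (cong (λ m → P (suc u) 0 (m + count F₀?)) (count-empty F₁? (λ S p → 1+n≢0 (r _ p)))))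
    (≤-trans (P-nil (count F₀?)) (+-mono-≤ (up₀ 0 r) (≤-trans (Kruskal–Katona u 0 F₀ F₀? (suc-injective e) (λ S → r _)) (down₀ 0))))
    where
    P-nil : ∀ m → P (suc u) 0 m ≤ m + P u 0 m
    P-nil zero = z≤n
    P-nil (suc m) = lemma u
      where
      lemma : ∀ u → suc u ≤ suc m + P u 0 (suc m)
      lemma zero = s≤s z≤n
      lemma (suc u) = s≤s (m≤n+m _ m)
  -- The alternatives of `P-split` correspond to bounding F₀ ∪ ∇F₁ from below by ∇F₁ or by F₀.
  bound (suc v) e r with P-split u v (count F₁?) (count F₀?)
      (≤-trans (count-mono F₁? (Rank? v) (λ S p → suc-injective (r _ p))) (≤-reflexive (count-Rank (suc u) v e₁)))
      (≤-trans (count-mono F₀? (Rank? (suc v)) (λ S p → r _ p)) (≤-reflexive (count-Rank u (suc v) (suc-injective e))))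
    where
    e₁ : suc u + v ≡ n
    e₁ = trans (sym (+-suc u v)) (suc-injective e)
  ... | inj₁ h = ≤-trans h (+-mono-≤
          (≤-trans (Kruskal–Katona (suc u) v F₁ F₁? (trans (sym (+-suc u v)) (suc-injective e)) (λ S p → suc-injective (r _ p))) (up₁ v))
          (≤-trans (Kruskal–Katona u (suc v) F₀ F₀? (suc-injective e) (λ S p → r _ p)) (down₀ (suc v))))
  ... | inj₂ h = ≤-trans h (+-mono-≤ (up₀ (suc v) r)
          (≤-trans (Kruskal–Katona u (suc v) F₀ F₀? (suc-injective e) (λ S p → r _ p)) (down₀ (suc v))))

-- The last sets in squashed order

infix 4 _≺_
-- Structural form of `SqLt`. The last difference decides, so `first` requires equal tails while
-- `later` leaves the heads arbitrary. As the final entry dominates, recursion along this order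
-- splits vectors at the end.
data _≺_ : ∀ {n} → Subset n → Subset n → Set where
  first : ∀ {n} {A B : Subset n} → A ≡ B → false ∷ A ≺ true ∷ B
  later : ∀ {n a b} {A B : Subset n} → A ≺ B → a ∷ A ≺ b ∷ B

lookup-ext : (A B : Subset n) → (∀ j → lookup A j ≡ lookup B j) → A ≡ B
lookup-ext [] [] e = refl
lookup-ext (a ∷ A) (b ∷ B) e = cong₂ _∷_ (e Fin.zero) (lookup-ext A B (e ∘ Fin.suc))

SqLt⇒≺ : {A B : Subset n} → SqLt A B → A ≺ B
SqLt⇒≺ {A = false ∷ A} {true ∷ B} (Fin.zero , _ , here , e) = first (lookup-ext A B (λ j → e (Fin.suc j) (s≤s z≤n)))
SqLt⇒≺ {A = true ∷ A} (Fin.zero , ∉A , _) = contradiction here ∉A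
SqLt⇒≺ {A = a ∷ A} {b ∷ B} (Fin.suc i , ∉A , there ∈B , e) =
  later (SqLt⇒≺ (i , ∉A ∘ there , ∈B , λ j i<j → e (Fin.suc j) (s≤s i<j)))

≺⇒SqLt : {A B : Subset n} → A ≺ B → SqLt A B
≺⇒SqLt (first refl) = Fin.zero , (λ ()) , here , λ { (Fin.suc j) _ → refl }
≺⇒SqLt (later A≺B) = let (i , ∉A , ∈B , e) = ≺⇒SqLt A≺B in
  Fin.suc i , ∉A ∘ drop-there , there ∈B , λ { (Fin.suc j) (s≤s i<j) → e j i<j }

≺-false-true : (A B : Subset n) → A ∷ʳ false ≺ B ∷ʳ true
≺-false-true [] [] = first refl
≺-false-true (a ∷ A) (b ∷ B) = later (≺-false-true A B)

≺-true-false : (A B : Subset n) → ¬ (A ∷ʳ true ≺ B ∷ʳ false)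
≺-true-false [] [] (later ())
≺-true-false (a ∷ A) (b ∷ B) (first e) with ∷ʳ-injectiveʳ A B e
... | ()
≺-true-false (a ∷ A) (b ∷ B) (later l) = ≺-true-false A B l

≺-∷ʳ⁺ : ∀ x {A B : Subset n} → A ≺ B → A ∷ʳ x ≺ B ∷ʳ x
≺-∷ʳ⁺ x (first refl) = first refl
≺-∷ʳ⁺ x (later l) = later (≺-∷ʳ⁺ x l)

≺-∷ʳ⁻ : ∀ x (A B : Subset n) → A ∷ʳ x ≺ B ∷ʳ x → A ≺ B
≺-∷ʳ⁻ x [] [] (later ())
≺-∷ʳ⁻ x (a ∷ A) (b ∷ B) (first e) = first (∷ʳ-injectiveˡ A B e)
≺-∷ʳ⁻ x (a ∷ A) (b ∷ B) (later l) = later (≺-∷ʳ⁻ x A B l)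

∣∷ʳtrue∣ : (S : Subset n) → ∣ S ∷ʳ true ∣ ≡ suc ∣ S ∣
∣∷ʳtrue∣ [] = refl
∣∷ʳtrue∣ (true ∷ S) = cong suc (∣∷ʳtrue∣ S)
∣∷ʳtrue∣ (false ∷ S) = ∣∷ʳtrue∣ S

∣∷ʳfalse∣ : (S : Subset n) → ∣ S ∷ʳ false ∣ ≡ ∣ S ∣
∣∷ʳfalse∣ [] = refl
∣∷ʳfalse∣ (true ∷ S) = cong suc (∣∷ʳfalse∣ S)
∣∷ʳfalse∣ (false ∷ S) = ∣∷ʳfalse∣ S

⊆-∷ʳ⁻ : ∀ x y (S T : Subset n) → S ∷ʳ x ⊆ T ∷ʳ y → S ⊆ T
⊆-∷ʳ⁻ x y (true ∷ S) (false ∷ T) l _ with l here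
... | ()
⊆-∷ʳ⁻ x y (true ∷ S) (true ∷ T) l here = here
⊆-∷ʳ⁻ x y (s ∷ S) (t ∷ T) l (there p) = there (⊆-∷ʳ⁻ x y S T (drop-∷-⊆ l) p)

true⊈false : (S T : Subset n) → ¬ (S ∷ʳ true ⊆ T ∷ʳ false)
true⊈false [] [] l with l here
... | ()
true⊈false (s ∷ S) (t ∷ T) l = true⊈false S T (drop-∷-⊆ l)

⊆∧<⇒⊂ : (S T : Subset n) → S ⊆ T → ∣ S ∣ < ∣ T ∣ → S ⊂ T
⊆∧<⇒⊂ (false ∷ S) (true ∷ T) l g = out⊂in (drop-∷-⊆ l)
⊆∧<⇒⊂ (false ∷ S) (false ∷ T) l g = out⊂ (⊆∧<⇒⊂ S T (drop-∷-⊆ l) g)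
⊆∧<⇒⊂ (true ∷ S) (true ∷ T) l (s≤s g) = in⊂in (⊆∧<⇒⊂ S T (drop-∷-⊆ l) g)
⊆∧<⇒⊂ (true ∷ S) (false ∷ T) l g with l here
... | ()

After? : ∀ r (S : Subset n) → Decidable (λ T → ∣ T ∣ ≡ r × SqLt S T)
After? r S T = (∣ T ∣ ≟ r) ×-dec SqLt? S T

after-true : ∀ r (S : Subset n) → count (After? (suc r) (S ∷ʳ true)) ≡ count (After? r S)
after-true r S = trans (count-∷ʳ (After? (suc r) (S ∷ʳ true))) (trans (cong₂ _+_
  (count-cong (After? (suc r) (S ∷ʳ true) ∘ (_∷ʳ true)) (After? r S)
    (λ T (e , l) → suc-injective (trans (sym (∣∷ʳtrue∣ T)) e) , ≺⇒SqLt (≺-∷ʳ⁻ true S T (SqLt⇒≺ l)))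
    (λ T (e , l) → trans (∣∷ʳtrue∣ T) (cong suc e) , ≺⇒SqLt (≺-∷ʳ⁺ true (SqLt⇒≺ l))))
  (count-empty (After? (suc r) (S ∷ʳ true) ∘ (_∷ʳ false)) (λ T (_ , l) → ≺-true-false S T (SqLt⇒≺ l))))
  (+-identityʳ _))

after-false-false : ∀ r (S : Subset n) → count (After? r (S ∷ʳ false) ∘ (_∷ʳ false)) ≡ count (After? r S)
after-false-false r S = count-cong (After? r (S ∷ʳ false) ∘ (_∷ʳ false)) (After? r S)
  (λ T (e , l) → trans (sym (∣∷ʳfalse∣ T)) e , ≺⇒SqLt (≺-∷ʳ⁻ false S T (SqLt⇒≺ l)))
  (λ T (e , l) → trans (∣∷ʳfalse∣ T) e , ≺⇒SqLt (≺-∷ʳ⁺ false (SqLt⇒≺ l)))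

after-false : ∀ r (S : Subset n) → count (After? (suc r) (S ∷ʳ false)) ≡ count {n} (Rank? r) + count (After? (suc r) S)
after-false r S = trans (count-∷ʳ (After? (suc r) (S ∷ʳ false))) (cong₂ _+_
  (count-cong (After? (suc r) (S ∷ʳ false) ∘ (_∷ʳ true)) (Rank? r)
    (λ T (e , l) → suc-injective (trans (sym (∣∷ʳtrue∣ T)) e))
    (λ T e → trans (∣∷ʳtrue∣ T) (cong suc e) , ≺⇒SqLt (≺-false-true S T)))
  (after-false-false (suc r) S))

after-false-zero : (S : Subset n) → count (After? 0 (S ∷ʳ false)) ≡ count (After? 0 S)
after-false-zero S = trans (count-∷ʳ (After? 0 (S ∷ʳ false))) (cong₂ _+_
  (count-empty (After? 0 (S ∷ʳ false) ∘ (_∷ʳ true)) (λ T (e , _) → 1+n≢0 (trans (sym (∣∷ʳtrue∣ T)) e)))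
  (after-false-false 0 S))

L-true⁻ : ∀ r m (S : Subset n) → L (suc n) (suc r) m (S ∷ʳ true) → L n r m S
L-true⁻ r m S (e , l) = suc-injective (trans (sym (∣∷ʳtrue∣ S)) e) , subst (_< m) (after-true r S) l

L-true⁺ : ∀ r m (S : Subset n) → L n r m S → L (suc n) (suc r) m (S ∷ʳ true)
L-true⁺ r m S (e , l) = trans (∣∷ʳtrue∣ S) (cong suc e) , subst (_< m) (sym (after-true r S)) l

-- All sets with the largest element come after those without it, so they use up `count (Rank? r)`
-- of the m places. The same truncated subtraction drives the recursion of `P`.
L-false⁻ : ∀ r m (S : Subset n) → L (suc n) (suc r) m (S ∷ʳ false) → L n (suc r) (m ∸ count {n} (Rank? r)) S
L-false⁻ {n} r m S (e , l) = trans (sym (∣∷ʳfalse∣ S)) e ,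
  m+n≤o⇒m≤o∸n _ (≤-trans (≤-reflexive (cong suc (trans (+-comm (count (After? (suc r) S)) _) (sym (after-false r S))))) l)

L-false⁺ : ∀ r m (S : Subset n) → L n (suc r) (m ∸ count {n} (Rank? r)) S → L (suc n) (suc r) m (S ∷ʳ false)
L-false⁺ {n} r m S (e , l) = trans (∣∷ʳfalse∣ S) e ,
  ≤-trans (≤-reflexive (cong suc (trans (after-false r S) (+-comm (count {n} (Rank? r)) _))))
    (m≤o∸n⇒m+n≤o _ (<⇒≤ (m∸n≢0⇒n<m {m} {count {n} (Rank? r)} (λ z → n≮0 (subst (count (After? (suc r) S) <_) z l)))) l)

L-false-zero⁺ : ∀ m (S : Subset n) → L n 0 m S → L (suc n) 0 m (S ∷ʳ false)
L-false-zero⁺ m S (e , l) = trans (∣∷ʳfalse∣ S) e , subst (_< m) (sym (after-false-zero S)) l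

L-zero : ∀ {r} (S : Subset n) → ¬ L n r 0 S
L-zero S (_ , ())

count-∷ʳ-≤ : {F : Subset (suc n) → Set} (F? : Decidable F) → ∀ {x y} →
             count (F? ∘ (_∷ʳ true)) ≤ x → count (F? ∘ (_∷ʳ false)) ≤ y → count F? ≤ x + y
count-∷ʳ-≤ F? p q = ≤-trans (≤-reflexive (count-∷ʳ F?)) (+-mono-≤ p q)

count-∷ʳ-≥ : {F : Subset (suc n) → Set} {G H : Subset n → Set}
             (F? : Decidable F) (G? : Decidable G) (H? : Decidable H) →
             (∀ S → G S → F (S ∷ʳ true)) → (∀ S → H S → F (S ∷ʳ false)) → count G? + count H? ≤ count F?
count-∷ʳ-≥ F? G? H? g h = ≤-trans (+-mono-≤ (count-mono G? (F? ∘ (_∷ʳ true)) g) (count-mono H? (F? ∘ (_∷ʳ false)) h))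
  (≤-reflexive (sym (count-∷ʳ F?)))

count-L : ∀ u v {n} → u + v ≡ n → ∀ m → m ≤ c u v → m ≤ count (L? n v m)
count-L zero zero refl zero l = z≤n
count-L zero zero refl (suc m) (s≤s z≤n) = count-pos (L? 0 0 1) [] (refl ,
  s≤s (≤-reflexive (count-empty (After? 0 []) (λ _ ()))))
count-L zero (suc v) refl m l = ≤-trans (≤-trans (count-L zero v refl m l) (m≤m+n _ _))
  (count-∷ʳ-≥ (L? (suc v) (suc v) m) (L? v v m) (λ S → L? (suc v) (suc v) m (S ∷ʳ false)) (L-true⁺ v m) (λ _ p → p))
count-L (suc u) zero refl m l = ≤-trans
  (≤-trans (count-L u 0 refl m (≤-trans l (≤-reflexive (sym (c-zeroʳ u))))) (m≤n+m _ _))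
  (count-∷ʳ-≥ (L? (suc (u + 0)) 0 m) (λ S → L? (suc (u + 0)) 0 m (S ∷ʳ true)) (L? (u + 0) 0 m) (λ _ p → p) (L-false-zero⁺ m))
count-L (suc u) (suc v) refl m l = ≤-trans (split (compare-+ m cA))
  (count-∷ʳ-≥ (L? (suc N) (suc v) m) (L? N v m) (L? N (suc v) (m ∸ count {N} (Rank? v))) (L-true⁺ v m) (L-false⁺ v m))
  where
  N = u + suc v
  cA = c (suc u) v
  R≡ : count {N} (Rank? v) ≡ cA
  R≡ = count-Rank (suc u) v (sym (+-suc u v))
  split : m ≤ cA ⊎ (∃ λ y → m ≡ cA + y) → m ≤ count (L? N v m) + count (L? N (suc v) (m ∸ count {N} (Rank? v)))
  split (inj₁ m≤) = ≤-trans (count-L (suc u) v (sym (+-suc u v)) m m≤) (m≤m+n _ _)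
  split (inj₂ (y , refl)) = +-mono-≤
    (≤-trans (count-L (suc u) v (sym (+-suc u v)) cA ≤-refl)
      (count-mono (L? N v cA) (L? N v m) (λ { S (e , p) → e , ≤-trans p (m≤m+n cA y) })))
    (≤-trans (count-L u (suc v) refl y (+-cancelˡ-≤ cA _ _ l))
      (≤-reflexive (cong (λ k → count (L? N (suc v) k)) (sym (trans (cong (cA + y ∸_) R≡) (m+n∸m≡n cA y))))))

-- For m ≤ `cA` all the last m sets contain the largest element, and removing it gives the same
-- situation one dimension lower. For larger m the part of the shade with that element is bounded by
-- its whole level, which is the saturated value of `P`. The reverse bound is Kruskal-Katona.
Shade-L : ∀ u v {n} → u + v ≡ n → ∀ m → count (Shade? v (L? n v m)) ≤ P u v m
Shade-L zero v {n} e m = ≤-reflexive (count-empty (Shade? v (L? n v m))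
  (λ X (e' , _) → <-irrefl refl (≤-trans (≤-reflexive (trans (cong suc (sym e)) (sym e'))) (∣p∣≤n X))))
Shade-L (suc u) zero {n} e zero = ≤-reflexive (count-empty (Shade? 0 (L? n 0 0)) (λ { X (_ , Y , p , _) → L-zero Y p }))
Shade-L (suc u) zero {n} e (suc m) = ≤-trans
  (count-mono (Shade? 0 (L? n 0 (suc m))) (Rank? 1) (λ _ → proj₁))
  (≤-reflexive (trans (count-Rank u 1 (trans (+-suc u 0) e)) (c-oneʳ u)))
Shade-L (suc u) (suc v) refl m = count-∷ʳ-≤ S? (top (≤-total m cA)) bottom
  where
  N = u + suc v
  cA = c (suc u) v
  S? = Shade? (suc v) (L? (suc N) (suc v) m)
  R≡ : count {N} (Rank? v) ≡ cA
  R≡ = count-Rank (suc u) v (sym (+-suc u v))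
  L₀ : ∀ S → L (suc N) (suc v) m (S ∷ʳ false) → L N (suc v) (m ∸ cA) S
  L₀ S p = subst (λ k → L N (suc v) (m ∸ k) S) R≡ (L-false⁻ v m S p)
  bottom : count (S? ∘ (_∷ʳ false)) ≤ P u (suc v) (m ∸ cA)
  bottom = ≤-trans (count-mono (S? ∘ (_∷ʳ false)) (Shade? (suc v) (L? N (suc v) (m ∸ cA))) sub) (Shade-L u (suc v) refl (m ∸ cA))
    where
    sub : ∀ X → Shade (suc v) (L (suc N) (suc v) m) (X ∷ʳ false) → Shade (suc v) (L N (suc v) (m ∸ cA)) X
    sub X (e , Y , p , Y⊂X) with initLast Y
    ... | Y' , true , refl = ⊥-elim (true⊈false Y' X (proj₁ Y⊂X))
    ... | Y' , false , refl = e' , Y' , L₀ Y' p ,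
          ⊆∧<⇒⊂ Y' X (⊆-∷ʳ⁻ false false Y' X (proj₁ Y⊂X)) (≤-reflexive (trans (cong suc (proj₁ (L₀ Y' p))) (sym e')))
      where
      e' : ∣ X ∣ ≡ suc (suc v)
      e' = trans (sym (∣∷ʳfalse∣ X)) e
  top : m ≤ cA ⊎ cA ≤ m → count (S? ∘ (_∷ʳ true)) ≤ P (suc u) v m
  top (inj₁ m≤) = ≤-trans (count-mono (S? ∘ (_∷ʳ true)) (Shade? v (L? N v m)) sub) (Shade-L (suc u) v (sym (+-suc u v)) m)
    where
    sub : ∀ X → Shade (suc v) (L (suc N) (suc v) m) (X ∷ʳ true) → Shade v (L N v m) X
    sub X (e , Y , p , Y⊂X) with initLast Y
    ... | Y' , false , refl = ⊥-elim (L-zero Y' (subst (λ k → L N (suc v) k Y') (m≤n⇒m∸n≡0 m≤) (L₀ Y' p)))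
    ... | Y' , true , refl = e' , Y' , L-true⁻ v m Y' p ,
          ⊆∧<⇒⊂ Y' X (⊆-∷ʳ⁻ true true Y' X (proj₁ Y⊂X)) (≤-reflexive (trans (cong suc (proj₁ (L-true⁻ v m Y' p))) (sym e')))
      where
      e' : ∣ X ∣ ≡ suc v
      e' = suc-injective (trans (sym (∣∷ʳtrue∣ X)) e)
  top (inj₂ m≥) = ≤-trans (count-mono (S? ∘ (_∷ʳ true)) (Rank? (suc v)) (λ X (e , _) → suc-injective (trans (sym (∣∷ʳtrue∣ X)) e)))
    (≤-reflexive (trans (count-Rank u (suc v) refl) (sym (P-sat (suc u) v m≥))))

-- Symmetric chains

-- The symmetric chain decomposition of Greene and Kleitman: read true as a
-- closing and false as an opening bracket.  The unmatched brackets form a word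
-- true^i false^j with i = ones S and i + j = free S, and the chain of S
-- consists of the sets rechain t S, t ≤ free S, obtained by making the first t
-- of them true and the remaining ones false.
ones : Subset n → ℕ
ones [] = 0
ones (true ∷ S) = suc (ones S)
ones (false ∷ S) = pred (ones S)

-- Effect of a prepended opening bracket on the number of unmatched ones: it pairs with the first
-- unmatched closing bracket if there is one, and is unmatched itself otherwise.
matchFree : ℕ → ℕ → ℕ
matchFree zero w = suc w
matchFree (suc _) w = pred w

free : Subset n → ℕ
free [] = 0
free (true ∷ S) = suc (free S)
free (false ∷ S) = matchFree (ones S) (free S)

rechain : ℕ → Subset n → Subset n
unmatchedHead : ℕ → Subset n → Subset (suc n)
falseHead : ℕ → ℕ → Subset n → Subset (suc n)

rechain t [] = []
rechain t (true ∷ S) = unmatchedHead t S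
rechain t (false ∷ S) = falseHead (ones S) t S

unmatchedHead zero S = false ∷ rechain zero S
unmatchedHead (suc t) S = true ∷ rechain t S

falseHead zero t S = unmatchedHead t S
-- The head is matched with the first unmatched true of `S`, which therefore has to stay true.
falseHead (suc _) t S = false ∷ rechain (suc t) S

ones≤free : (S : Subset n) → ones S ≤ free S
ones≤free [] = z≤n
ones≤free (true ∷ S) = s≤s (ones≤free S)
ones≤free (false ∷ S) with ones S | ones≤free S
... | zero | _ = z≤n
... | suc i | l = <⇒≤pred l

≤pred⇒< : ∀ {i m n} → suc i ≤ n → m ≤ pred n → m < n
≤pred⇒< (s≤s _) m≤ = s≤s m≤

record Rechain {n} (t : ℕ) (S R : Subset n) (w : ℕ) : Set where
  field
    ones-eq : ones R ≡ t
    free-eq : free R ≡ w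
    again : ∀ s → s ≤ w → rechain s R ≡ rechain s S

open Rechain

rechain-spec : ∀ t (S : Subset n) → t ≤ free S → Rechain t S (rechain t S) (free S)
unmatched-spec : ∀ t (S : Subset n) → t ≤ suc (free S) →
  ones (unmatchedHead t S) ≡ t × free (unmatchedHead t S) ≡ suc (free S) ×
  (∀ s → s ≤ suc (free S) → rechain s (unmatchedHead t S) ≡ unmatchedHead s S)

rechain-spec zero [] z≤n = record { ones-eq = refl ; free-eq = refl ; again = λ _ _ → refl }
rechain-spec t (true ∷ S) l = let (o , f , a) = unmatched-spec t S l in
  record { ones-eq = o ; free-eq = f ; again = a }
rechain-spec t (false ∷ S) l with ones S in eq | ones≤free S
... | zero | _ = let (o , f , a) = unmatched-spec t S l in record
  { ones-eq = o ; free-eq = f ; again = λ s s≤ → trans (a s s≤) (sym (cong (λ k → falseHead k s S) eq)) }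
... | suc i | g = record
  { ones-eq = cong pred (ones-eq r)
  ; free-eq = trans (cong₂ matchFree (ones-eq r) (free-eq r)) refl
  ; again = λ s s≤ → trans (cong (λ k → falseHead k s (rechain (suc t) S)) (ones-eq r))
      (trans (cong (false ∷_) (again r (suc s) (≤pred⇒< g s≤))) (sym (cong (λ k → falseHead k s S) eq))) }
  where
  r = rechain-spec (suc t) S (≤pred⇒< g l)

unmatched-spec zero S l = cong pred (ones-eq r) , cong₂ matchFree (ones-eq r) (free-eq r) , step
  where
  r = rechain-spec 0 S z≤n
  step : ∀ s → s ≤ suc (free S) → falseHead (ones (rechain 0 S)) s (rechain 0 S) ≡ unmatchedHead s S
  step zero s≤ rewrite ones-eq r = cong (false ∷_) (again r 0 z≤n)
  step (suc s) (s≤s s≤) rewrite ones-eq r = cong (true ∷_) (again r s s≤)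
unmatched-spec (suc t) S (s≤s l) = cong suc (ones-eq r) , cong suc (free-eq r) , step
  where
  r = rechain-spec t S l
  step : ∀ s → s ≤ suc (free S) → unmatchedHead s (rechain t S) ≡ unmatchedHead s S
  step zero s≤ = cong (false ∷_) (again r 0 z≤n)
  step (suc s) (s≤s s≤) = cong (true ∷_) (again r s s≤)

rechain-ones : (S : Subset n) → rechain (ones S) S ≡ S
rechain-ones [] = refl
rechain-ones (true ∷ S) = cong (true ∷_) (rechain-ones S)
rechain-ones (false ∷ S) with ones S | rechain-ones S
... | zero | e = cong (false ∷_) e
... | suc i | e = cong (false ∷_) e

rechain-mono : ∀ {s t} (S : Subset n) → s ≤ t → rechain s S ⊆ rechain t S
unmatched-mono : ∀ {s t} (S : Subset n) → s ≤ t → unmatchedHead s S ⊆ unmatchedHead t S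

rechain-mono [] l = λ ()
rechain-mono (true ∷ S) l = unmatched-mono S l
rechain-mono (false ∷ S) l with ones S
... | zero = unmatched-mono S l
... | suc i = out⊆ (rechain-mono S (s≤s l))

unmatched-mono {t = zero} S z≤n = out⊆ (rechain-mono S z≤n)
unmatched-mono {t = suc t} S z≤n = out⊆ (rechain-mono S z≤n)
unmatched-mono S (s≤s l) = in⊆in (rechain-mono S l)

rechain-size : ∀ t (S : Subset n) → t ≤ free S → ∣ rechain t S ∣ + ones S ≡ ∣ S ∣ + t
unmatched-size : ∀ t (S : Subset n) → t ≤ suc (free S) → ∣ unmatchedHead t S ∣ + ones S ≡ ∣ S ∣ + t

rechain-size zero [] z≤n = refl
rechain-size t (true ∷ S) l = trans (+-suc _ (ones S)) (cong suc (unmatched-size t S l))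
rechain-size t (false ∷ S) l with ones S | ones≤free S | unmatched-size t S | rechain-size (suc t) S
... | zero | _ | u | _ = u l
... | suc i | g | _ | r = suc-injective (trans (sym (+-suc _ i)) (trans (r (≤pred⇒< g l)) (+-suc _ t)))

unmatched-size zero S l = rechain-size zero S z≤n
unmatched-size (suc t) S (s≤s l) = trans (cong suc (rechain-size t S l)) (sym (+-suc _ t))

-- There are |S| - `ones S` matched trues and as many matched falses; together with the `free S`
-- unmatched entries they make up all n positions.
chain-symmetric : (S : Subset n) → ∣ S ∣ + ∣ S ∣ + free S ≡ n + (ones S + ones S)
chain-symmetric [] = refl
chain-symmetric {suc n} (true ∷ S) = ≤-antisym
  (lin (∣ S ∣ ∷ free S ∷ n ∷ ones S ∷ []) (λ s f n o → s :+ s :+ f :≡ n :+ (o :+ o) ⇒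
    goal (lit 1 :+ s :+ (lit 1 :+ s) :+ (lit 1 :+ f)) (lit 1 :+ n :+ (lit 1 :+ o :+ (lit 1 :+ o)))) (chain-symmetric S))
  (lin (∣ S ∣ ∷ free S ∷ n ∷ ones S ∷ []) (λ s f n o → n :+ (o :+ o) :≡ s :+ s :+ f ⇒
    goal (lit 1 :+ n :+ (lit 1 :+ o :+ (lit 1 :+ o))) (lit 1 :+ s :+ (lit 1 :+ s) :+ (lit 1 :+ f))) (sym (chain-symmetric S)))
chain-symmetric {suc n} (false ∷ S) with ones S | ones≤free S | chain-symmetric S
... | zero | _ | e = trans (+-suc _ (free S)) (cong suc e)
... | suc i | g | e with free S | g
... | suc w | _ = suc-injective (trans (sym (+-suc (∣ S ∣ + ∣ S ∣) w)) (trans e (trans (+-suc n _) (cong suc (trans (cong (n +_) (+-suc i i)) (+-suc n (i + i)))))))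

mid : ℕ → Subset n → Subset n
mid h S = rechain (ones S + (h ∸ ∣ S ∣)) S

module _ (h : ℕ) (n≡ : n ≡ 2 * h) (S : Subset n) (S≤h : ∣ S ∣ ≤ h) where

  mid-free : ones S + (h ∸ ∣ S ∣) ≤ free S
  mid-free = lin (ones S ∷ h ∸ ∣ S ∣ ∷ ∣ S ∣ ∷ h ∷ n ∷ free S ∷ [])
    (λ o d s h n f → n :+ (o :+ o) :≡ s :+ s :+ f ⇒ s :+ d :≡ h ⇒ s :+ d :≡ h ⇒ h :+ (h :+ lit 0) :≡ n ⇒ goal (o :+ d) f)
    (sym (chain-symmetric S)) (m+[n∸m]≡n S≤h) (m+[n∸m]≡n S≤h) (sym n≡)

  mid-size : ∣ mid h S ∣ ≡ h
  mid-size = +-cancelʳ-≡ (ones S) _ _ (trans (rechain-size _ S mid-free)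
    (trans (cong (∣ S ∣ +_) (+-comm (ones S) _)) (trans (sym (+-assoc ∣ S ∣ _ (ones S))) (cong (_+ ones S) (m+[n∸m]≡n S≤h)))))

  mid-⊇ : S ⊆ mid h S
  mid-⊇ = subst (_⊆ mid h S) (rechain-ones S) (rechain-mono S (m≤m+n (ones S) _))

  mid-recover : rechain (ones S) (mid h S) ≡ S
  mid-recover = trans (again (rechain-spec _ S mid-free) (ones S) (ones≤free S)) (rechain-ones S)

-- Sets with the same middle set lie on the same chain, where they are recovered at the parameters
-- `ones S` and `ones T`.
mid-comparable : ∀ h → n ≡ 2 * h → (S T : Subset n) → ∣ S ∣ ≤ h → ∣ T ∣ ≤ h → mid h S ≡ mid h T →
                 S ⊆ T ⊎ T ⊆ S
mid-comparable h n≡ S T S≤ T≤ e with ≤-total (ones S) (ones T)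
... | inj₁ l = inj₁ (subst₂ _⊆_ (mid-recover h n≡ S S≤)
        (trans (cong (rechain (ones T)) e) (mid-recover h n≡ T T≤)) (rechain-mono (mid h S) l))
... | inj₂ l = inj₂ (subst₂ _⊆_ (mid-recover h n≡ T T≤)
        (trans (cong (rechain (ones S)) (sym e)) (mid-recover h n≡ S S≤)) (rechain-mono (mid h T) l))

-- Pushing an antichain to the middle levels

⊆∧≥⇒≡ : (S T : Subset n) → S ⊆ T → ∣ T ∣ ≤ ∣ S ∣ → S ≡ T
⊆∧≥⇒≡ S T S⊆T le with m≤n⇒m<n∨m≡n (p⊆q⇒∣p∣≤∣q∣ S⊆T)
... | inj₁ l = contradiction (≤-trans l le) (<-irrefl refl)
... | inj₂ e = ⊆-antisym S⊆T (λ {x} → back x)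
  where
  back : ∀ x → x ∈ T → x ∈ S
  back x x∈T with x ∈? S
  ... | yes x∈S = x∈S
  ... | no x∉S = contradiction (p⊂q⇒∣p∣<∣q∣ (S⊆T , x , x∈T , x∉S)) (<-irrefl e)

-- Below the middle, the factor u = n - r of `P-LYM` exceeds the factor r + 1.
shade-grows : ∀ h r {n} (F : Subset n → Set) (F? : Decidable F) → n ≡ 2 * h → r < h → (∀ S → F S → ∣ S ∣ ≡ r) →
              count F? ≤ count (Shade? r F?) × (1 ≤ count F? → count F? < count (Shade? r F?))
shade-grows h r {n} F F? n≡ r<h rank with m≤n⇒∃[o]m+o≡n r<h
... | o , refl = ≤-trans (weak m refl) kk , λ pos → ≤-trans (strong m pos refl) kk
  where
  m = count F?
  u = 2 + r + o + o
  size : u + r ≡ n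
  size = trans (arrange r o) (sym n≡)
    where
    arrange : ∀ r o → 2 + r + o + o + r ≡ 2 * (1 + r + o)
    arrange = solve-∀
  kk : P u r m ≤ count (Shade? r F?)
  kk = Kruskal–Katona u r F F? size rank
  lym : u * m ≤ suc r * P u r m
  lym = P-LYM u r m (≤-trans (count-mono F? (Rank? r) rank) (≤-reflexive (count-Rank u r size)))
  expand : ∀ r o m → (2 + r + o + o) * m ≡ suc r * m + m + (o + o) * m
  expand = solve-∀
  strong : ∀ k → 1 ≤ k → k ≡ m → k < P u r m
  strong k pos refl = *-cancelˡ-< (suc r) _ _ (≤-trans
    (lin (suc r * m ∷ m ∷ (o + o) * m ∷ u * m ∷ []) (λ a m b w → a :+ m :+ b :≡ w ⇒ lit 1 :≤ m ⇒ goal (lit 1 :+ a) w) (sym (expand r o m)) pos)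
    lym)
  weak : ∀ k → k ≡ m → k ≤ P u r m
  weak zero e = z≤n
  weak (suc k) e = <⇒≤ (strong (suc k) (s≤s z≤n) e)

∣∁∣+∣∣ : (S : Subset n) → ∣ ∁ S ∣ + ∣ S ∣ ≡ n
∣∁∣+∣∣ S = trans (cong (_+ ∣ S ∣) (∣∁p∣≡n∸∣p∣ S)) (m∸n+n≡m (∣p∣≤n S))

Incomparable : (Subset n → Set) → Set
Incomparable A = ∀ S T → A S → A T → ¬ S ⊂ T

module Closure {n} (A : Subset n → Set) (A? : Decidable A) where

  Up : ℕ → Subset n → Set
  Up r T = ∣ T ∣ ≡ r × ∃ λ S → A S × S ⊆ T

  Up? : ∀ r → Decidable (Up r)
  Up? r T = (∣ T ∣ ≟ r) ×-dec exists? (λ S → A? S ×-dec (S ⊆? T))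

  Below : ℕ → Subset n → Set
  Below r S = A S × ∣ S ∣ ≤ r

  Below? : ∀ r → Decidable (Below r)
  Below? r S = A? S ×-dec (∣ S ∣ ≤? r)

  -- Induction on the level: the shade of `Up r` and the members of size r + 1 are disjoint parts of
  -- `Up (suc r)`, since a member in the shade would properly contain another member. A member below
  -- the level makes `Up r` nonempty, and the growth of its shade strict.
  Below≤Up : ∀ h → n ≡ 2 * h → Incomparable A → ∀ r → r ≤ h →
             count (Below? r) ≤ count (Up? r) × (∀ S → A S → ∣ S ∣ < r → count (Below? r) < count (Up? r))
  Below≤Up h n≡ inc zero r≤h = count-mono (Below? 0) (Up? 0) (λ S (p , l) → n≤0⇒n≡0 l , S , p , ⊆-refl) , λ S p ()
  Below≤Up h n≡ inc (suc r) r<h = weak , strict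
    where
    At? : Decidable (λ S → A S × ∣ S ∣ ≡ suc r)
    At? S = A? S ×-dec (∣ S ∣ ≟ suc r)
    S? = Shade? r (Up? r)
    ih = Below≤Up h n≡ inc r (<⇒≤ r<h)
    grow = shade-grows h r (Up r) (Up? r) n≡ r<h (λ _ → proj₁)
    split : count (Below? (suc r)) ≤ count (Below? r) + count At?
    split = count-∪ (Below? r) At? (Below? (suc r)) cases
      where
      cases : ∀ S → Below (suc r) S → Below r S ⊎ (A S × ∣ S ∣ ≡ suc r)
      cases S (p , l) with m≤n⇒m<n∨m≡n l
      ... | inj₁ (s≤s l') = inj₁ (p , l')
      ... | inj₂ e = inj₂ (p , e)
    join : count S? + count At? ≤ count (Up? (suc r))
    join = count-⊎ S? At? (Up? (suc r))
      (λ { T (e , T' , (_ , S , p , S⊆T') , T'⊂T) → e , S , p , ⊆-trans S⊆T' (proj₁ T'⊂T) })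
      (λ { S (p , e) → e , S , p , ⊆-refl })
      (λ { T (_ , T' , (_ , S , p , S⊆T') , T'⊂T) (q , _) → inc S T p q (⊆-⊂-trans S⊆T' T'⊂T) })
    weak : count (Below? (suc r)) ≤ count (Up? (suc r))
    weak = lin (count (Below? (suc r)) ∷ count (Below? r) ∷ count At? ∷ count (Up? r) ∷ count S? ∷ count (Up? (suc r)) ∷ [])
      (λ b' b a u s u' → b' :≤ b :+ a ⇒ b :≤ u ⇒ u :≤ s ⇒ s :+ a :≤ u' ⇒ goal b' u')
      split (proj₁ ih) (proj₁ grow) join
    strict : ∀ S → A S → ∣ S ∣ < suc r → count (Below? (suc r)) < count (Up? (suc r))
    strict S p (s≤s l) = lin (count (Below? (suc r)) ∷ count (Below? r) ∷ count At? ∷ count (Up? r) ∷ count S? ∷ count (Up? (suc r)) ∷ [])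
      (λ b' b a u s u' → b' :≤ b :+ a ⇒ b :≤ u ⇒ lit 1 :+ u :≤ s ⇒ s :+ a :≤ u' ⇒ goal (lit 1 :+ b') u')
      split (proj₁ ih) (proj₂ grow (≤-trans (count-pos (Below? r) S (p , l)) (proj₁ ih))) join

-- Everything above level h is pushed down to level h + 1, which by
-- complementation is pushing up to level h' = h − 1.
module Middle {n} (h' : ℕ) (n≡ : n ≡ 2 * suc h') (A : Subset n → Set) (A? : Decidable A) (inc : Incomparable A) where

  h = suc h'

  open Closure A A? public
  module Dual = Closure (A ∘ ∁) (λ S → A? (∁ S))

  Down : Subset n → Set
  Down T = Dual.Up h' (∁ T)

  Down? : Decidable Down
  Down? T = Dual.Up? h' (∁ T)

  inc-∁ : Incomparable (A ∘ ∁)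
  inc-∁ S T p q S⊂T = inc (∁ T) (∁ S) q p (p⊂q⇒∁p⊃∁q S⊂T)

  ∣∁∣≤h' : ∀ S → suc h ≤ ∣ S ∣ → ∣ ∁ S ∣ ≤ h'
  ∣∁∣≤h' S l = lin (∣ ∁ S ∣ ∷ ∣ S ∣ ∷ h' ∷ n ∷ []) (λ d s h n → lit 2 :+ h :≤ s ⇒ d :+ s :≡ n ⇒ n :≡ (lit 1 :+ h) :+ ((lit 1 :+ h) :+ lit 0) ⇒ goal d h)
    l (∣∁∣+∣∣ S) n≡

  Down-rank : ∀ T → Down T → ∣ T ∣ ≡ suc h
  Down-rank T (e , _) = +-cancelˡ-≡ h' _ _ (trans (cong (_+ ∣ T ∣) (sym e)) (trans (∣∁∣+∣∣ T) (trans n≡ (arrange h'))))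
    where
    arrange : ∀ k → 2 * suc k ≡ k + suc (suc k)
    arrange = solve-∀

  Down-member : ∀ T → Down T → ∃ λ S → A S × T ⊆ S
  Down-member T (_ , S , p , S⊆) = ∁ S , p , subst (_⊆ ∁ S) (∁-involutive T) (p⊆q⇒∁p⊇∁q S⊆)

  Above : Subset n → Set
  Above S = A S × suc h ≤ ∣ S ∣

  Above? : Decidable Above
  Above? S = A? S ×-dec (suc h ≤? ∣ S ∣)

  ∁-Below : count Above? ≤ count (Dual.Below? h')
  ∁-Below = ≤-trans (count-mono Above? (Dual.Below? h' ∘ ∁)
      (λ S (p , l) → subst A (sym (∁-involutive S)) p , ∣∁∣≤h' S l))
    (≤-reflexive (count-∁ (Dual.Below? h')))

  Above≤Down : count Above? ≤ count Down?
  Above≤Down = ≤-trans ∁-Below (≤-trans (proj₁ (Dual.Below≤Up h n≡ inc-∁ h' (n≤1+n h'))) (≤-reflexive (sym (count-∁ (Dual.Up? h')))))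

  Above<Down : ∀ S → A S → suc h < ∣ S ∣ → count Above? < count Down?
  Above<Down S p l = ≤-trans (s≤s ∁-Below) (≤-trans
    (proj₂ (Dual.Below≤Up h n≡ inc-∁ h' (n≤1+n h')) (∁ S) (subst A (sym (∁-involutive S)) p) small)
    (≤-reflexive (sym (count-∁ (Dual.Up? h')))))
    where
    small : ∣ ∁ S ∣ < h'
    small = lin (∣ ∁ S ∣ ∷ ∣ S ∣ ∷ h' ∷ n ∷ []) (λ d s h n → lit 3 :+ h :≤ s ⇒ d :+ s :≡ n ⇒ n :≡ (lit 1 :+ h) :+ ((lit 1 :+ h) :+ lit 0) ⇒ goal (lit 1 :+ d) h)
      l (∣∁∣+∣∣ S) n≡

  count-A : count A? ≤ count (Below? h) + count Above?
  count-A = count-∪ (Below? h) Above? A? cases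
    where
    cases : ∀ S → A S → Below h S ⊎ Above S
    cases S p with ∣ S ∣ ≤? h
    ... | yes l = inj₁ (p , l)
    ... | no g = inj₂ (p , ≰⇒> g)

  -- Any part of `Up h` is allowed, so that this serves both for the whole of `Up h` in A and for
  -- the chain images `Mid` in B.
  module _ (Y : Subset n → Set) (Y? : Decidable Y) (Y⊆Up : ∀ T → Y T → Up h T) where

    Down-Shade-disjoint : ∀ T → Down T → ¬ Shade h Y T
    Down-Shade-disjoint T d (_ , T' , y , T'⊂T) =
      let (S , p , S⊆T') = proj₂ (Y⊆Up T' y)
          (S' , q , T⊆S') = Down-member T d
      in inc S S' p q (⊆-⊂-trans S⊆T' (⊂-⊆-trans T'⊂T T⊆S'))

    Down+Shade : count Down? + count (Shade? h Y?) ≤ count {n} (Rank? (suc h))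
    Down+Shade = count-⊎ Down? (Shade? h Y?) (Rank? (suc h)) Down-rank (λ _ → proj₁) Down-Shade-disjoint

    P≤Shade : P h h (count Y?) ≤ count (Shade? h Y?)
    P≤Shade = Kruskal–Katona h h Y Y? (trans (cong (h +_) (sym (+-identityʳ h))) (sym n≡)) (λ T y → proj₁ (Y⊆Up T y))

-- The upper bound for the total size and the case of equality

open ℤ using (+_; _-_)

c-comm : ∀ u v → c u v ≡ c v u
c-comm zero zero = refl
c-comm zero (suc v) = refl
c-comm (suc u) zero = refl
c-comm (suc u) (suc v) = trans (cong₂ _+_ (c-comm (suc u) v) (c-comm u (suc v))) (+-comm (c v (suc u)) _)

κ*≤κ : ∀ r {j k} → j ≤ k → κ* r k ℤ.≤ κ r j
κ*≤κ r {k = zero} z≤n = ℤₚ.≤-refl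
κ*≤κ r {j} {suc k} l with m≤n⇒m<n∨m≡n l
... | inj₁ (s≤s l') = ℤₚ.≤-trans (ℤₚ.i⊓j≤i (κ* r k) (κ r (suc k))) (κ*≤κ r l')
... | inj₂ refl = ℤₚ.i⊓j≤j (κ* r k) (κ r (suc k))

ℤ-bound : ∀ m N K κ s j → + m ≡ (+ N ℤ.+ + K) - κ → κ ℤ.≤ + s - + j → N + K + j ≤ m + s
ℤ-bound m N K κ s j e l = ℤₚ.drop‿+≤+ (begin
  + (N + K + j)                                ≡⟨ arrange (+ N) (+ K) κ (+ j) ⟩
  ((+ N ℤ.+ + K) - κ) ℤ.+ (κ ℤ.+ + j)          ≡⟨ cong (ℤ._+ (κ ℤ.+ + j)) (sym e) ⟩
  + m ℤ.+ (κ ℤ.+ + j)                          ≤⟨ ℤₚ.+-monoʳ-≤ (+ m) (ℤₚ.+-monoˡ-≤ (+ j) l) ⟩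
  + m ℤ.+ (+ s - + j ℤ.+ + j)                  ≡⟨ arrange′ (+ m) (+ s) (+ j) ⟩
  + (m + s)                                    ∎)
  where
  open ℤₚ.≤-Reasoning
  arrange : ∀ N K κ j → N ℤ.+ K ℤ.+ j ≡ ((N ℤ.+ K) - κ) ℤ.+ (κ ℤ.+ j)
  arrange = solveℤ-∀
  arrange′ : ∀ m s j → m ℤ.+ (s - j ℤ.+ j) ≡ m ℤ.+ s
  arrange′ = solveℤ-∀

-- By `c-absorb`, N - K = N / (h + 1), while `P-LYM` gives x - `P h h x` ≤ x / (h + 1) and likewise
-- for y. The excluded inequality would thus force N ≤ x + y.
no-small-total : ∀ h' x y → let h = suc h' ; N = c h h ; K = c h' (suc h) in x ≤ N → y ≤ N →
                 x + y < N → ¬ (N + P h h x + P h h y ≤ x + y + K)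
no-small-total h' x y x≤ y≤ g l = <-irrefl refl (≤-trans g N≤)
  where
  h = suc h'
  N = c h h
  K = c h' (suc h)
  expand₁ : ∀ h N p q → suc h * (N + p + q) ≡ N + h * N + suc h * p + suc h * q
  expand₁ = solve-∀
  expand₂ : ∀ h x y K → suc h * (x + y + K) ≡ h * x + h * y + (x + y) + suc h * K
  expand₂ = solve-∀
  N≤ : N ≤ x + y
  N≤ = lin (suc h * (N + P h h x + P h h y) ∷ N ∷ h * N ∷ suc h * P h h x ∷ suc h * P h h y ∷
            suc h * (x + y + K) ∷ h * x ∷ h * y ∷ x ∷ y ∷ suc h * K ∷ [])
    (λ L N hN p q R hx hy x y sK → N :+ hN :+ p :+ q :≡ L ⇒ L :≤ R ⇒ R :≡ hx :+ hy :+ (x :+ y) :+ sK ⇒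
       hx :≤ p ⇒ hy :≤ q ⇒ sK :≡ hN ⇒ goal N (x :+ y))
    (sym (expand₁ h N (P h h x) (P h h y))) (*-monoʳ-≤ (suc h) l) (expand₂ h x y K)
    (P-LYM h h x x≤) (P-LYM h h y y≤) (sym (c-absorb h' h))

-- Let z = `c u v` - y, so that x = j + z. The z entries after the first j are at least the last z
-- entries, which are the total less the first y.
P-intersection : ∀ u v {x y j} → x ≤ c u v → y ≤ c u v → x + y ≡ c u v + j → Tot u v + P u v j ≤ P u v x + P u v y
P-intersection u v {x} {y} {j} x≤ y≤ e with m≤n⇒∃[o]m+o≡n y≤
... | z , yz≡ = lin (P u v j ∷ Q u v z ∷ P u v (j + z) ∷ P u v x ∷ P u v y ∷ Tot u v ∷ [])
  (λ pj qz s px py t → pj :+ qz :≤ s ⇒ s :≡ px ⇒ t :≡ py :+ qz ⇒ goal (t :+ pj) (px :+ py))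
  (P-suffixMinimal u v j z (≤-trans (≤-reflexive jz≡) x≤)) (cong (P u v) jz≡) (sym (P+Q u v y z yz≡))
  where
  jz≡ : j + z ≡ x
  jz≡ = +-cancelʳ-≡ y _ _ (trans (arrange j z y) (trans (cong (_+ j) yz≡) (sym e)))
    where
    arrange : ∀ j z y → j + z + y ≡ y + z + j
    arrange = solve-∀

⊆∧⊆∁⇒∩≡⊥ : ∀ {n} (S R T : Subset n) → S ⊆ T → R ⊆ ∁ T → S ∩ R ≡ ⊥
⊆∧⊆∁⇒∩≡⊥ S R T S⊆ R⊆ = Empty-unique (λ (x , x∈) → let (x∈S , x∈R) = x∈p∩q⁻ S R x∈ in x∈∁p⇒x∉p (R⊆ x∈R) (S⊆ x∈S))

between : ∀ {m n} → ¬ m < n → ¬ suc n < m → m ≡ n ⊎ m ≡ suc n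
between {m} {n} ≮ ≯ with m≤n⇒m<n∨m≡n (≮⇒≥ ≮)
... | inj₂ e = inj₁ (sym e)
... | inj₁ g = inj₂ (≤-antisym (≮⇒≥ ≯) g)

half-conclusion : ∀ h' {n} → n ≡ 2 * suc h' →
  ∀ {p q} (a : Fin p → Subset n) (b : Fin q → Subset n) →
  Injective _≡_ _≡_ a → Injective _≡_ _≡_ b → Antichain a → Antichain b → ∀ k →
  (∀ i j → a i ∩ b j ≡ ⊥ → toℕ i ≡ toℕ j × suc (toℕ i) ≤ k) →
  + (p + q) ≡ (+ (n C suc h') ℤ.+ + (n C suc (suc h'))) - κ* (suc h') k →
  Conclusion n (suc h') a
half-conclusion h' {n} n≡ {p} {q} a b a-inj b-inj a-anti b-anti k cross total =
  conclusion
  where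
  inc : ∀ {p} (x : Fin p → Subset n) → Antichain x → Incomparable (Mem x)
  inc x anti _ _ (i , refl) (j , refl) l = anti i j (λ e → ⊂-irref e l) l

  module A = Middle h' n≡ (Mem a) (Mem? a) (inc a a-anti)
  module B = Middle h' n≡ (Mem b) (Mem? b) (inc b b-anti)
  open A using (h)

  N = c h h
  K = c h' (suc h)

  h+h≡n : h + h ≡ n
  h+h≡n = trans (cong (_+_ h) (sym (+-identityʳ h))) (sym n≡)
  rank-N : count {n} (Rank? h) ≡ N
  rank-N = count-Rank h h h+h≡n
  h'+≡n : h' + suc h ≡ n
  h'+≡n = trans (+-suc h' h) h+h≡n
  rank-K : count {n} (Rank? (suc h)) ≡ K
  rank-K = count-Rank h' (suc h) h'+≡n

  Mid : Subset n → Set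
  Mid T = ∃ λ j → ∣ b j ∣ ≤ h × mid h (b j) ≡ T
  Mid? : Decidable Mid
  Mid? T = any? (λ j → (∣ b j ∣ ≤? h) ×-dec ≡-dec 𝔹._≟_ (mid h (b j)) T)
  Mid⊆Up : ∀ T → Mid T → B.Up h T
  Mid⊆Up T (j , l , refl) = mid-size h n≡ (b j) l , b j , (j , refl) , mid-⊇ h n≡ (b j) l

  x = count (A.Up? h)
  y = count Mid?
  ∇U = count (Shade? h (A.Up? h))
  ∇Y = count (Shade? h Mid?)

  x≤N : x ≤ N
  x≤N = ≤-trans (count-mono (A.Up? h) (Rank? h) (λ _ → proj₁)) (≤-reflexive rank-N)
  y≤N : y ≤ N
  y≤N = ≤-trans (count-mono Mid? (Rank? h) (λ T t → proj₁ (Mid⊆Up T t))) (≤-reflexive rank-N)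

  -- An antichain meets each symmetric chain at most once, so `mid h` is injective on its members of
  -- size at most h.
  BelowB≤y : count (B.Below? h) ≤ y
  BelowB≤y = count-injection (B.Below? h) Mid? (mid h) (λ { S ((j , refl) , l) → j , l , refl }) same
    where
    same : ∀ S T → B.Below h S → B.Below h T → mid h S ≡ mid h T → S ≡ T
    same S T (p , S≤) (q , T≤) e with mid-comparable h n≡ S T S≤ T≤ e | <-≤-connex ∣ S ∣ ∣ T ∣
    ... | inj₁ S⊆T | inj₁ lt = contradiction (⊆∧<⇒⊂ S T S⊆T lt) (inc b b-anti S T p q)
    ... | inj₁ S⊆T | inj₂ le = ⊆∧≥⇒≡ S T S⊆T le
    ... | inj₂ T⊆S | inj₁ lt = sym (⊆∧≥⇒≡ T S T⊆S (<⇒≤ lt))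
    ... | inj₂ T⊆S | inj₂ le with m≤n⇒m<n∨m≡n le
    ... | inj₁ lt = contradiction (⊆∧<⇒⊂ T S T⊆S lt) (inc b b-anti T S q p)
    ... | inj₂ e' = sym (⊆∧≥⇒≡ T S T⊆S (≤-reflexive (sym e')))

  meet? : Decidable (λ T → A.Up h T × Mid (∁ T))
  meet? T = A.Up? h T ×-dec Mid? (∁ T)

  matched : ∀ T → A.Up h T × Mid (∁ T) → ∃ λ j → toℕ j < k × mid h (b j) ≡ ∁ T
  matched T ((_ , _ , (i , refl) , S⊆T) , (j , l , e)) with
    cross i j (⊆∧⊆∁⇒∩≡⊥ (a i) (b j) T S⊆T (subst (b j ⊆_) e (mid-⊇ h n≡ (b j) l)))
  ... | i≡j , i<k = j , subst (_< k) i≡j i<k , e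

  meet≤k : count meet? ≤ k
  meet≤k = count≤-Fin meet? (λ T m → fromℕ< (proj₁ (proj₂ (matched T m)))) inj
    where
    inj : ∀ S T s t → fromℕ< (proj₁ (proj₂ (matched S s))) ≡ fromℕ< (proj₁ (proj₂ (matched T t))) → S ≡ T
    inj S T s t e with matched S s | matched T t
    ... | j , j<k , eⱼ | j' , j'<k , eⱼ' with toℕ-injective {i = j} {j = j'}
            (trans (sym (toℕ-fromℕ< j<k)) (trans (cong toℕ e) (toℕ-fromℕ< j'<k)))
    ... | refl = trans (sym (∁-involutive S)) (trans (cong ∁ (trans (sym eⱼ) eⱼ')) (∁-involutive T))

  x+y≤N+k : x + y ≤ N + k
  x+y≤N+k = ≤-trans (≤-reflexive (cong (_+_ x) (sym (count-∁ Mid?)))) (≤-trans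
    (count-∩ (A.Up? h) (Mid? ∘ ∁) (Rank? h) meet? (λ _ → proj₁) rank)
    (+-mono-≤ (≤-reflexive rank-N) meet≤k))
    where
    rank : ∀ T → Mid (∁ T) → ∣ T ∣ ≡ h
    rank T t = +-cancelˡ-≡ h _ _ (trans (cong (_+ ∣ T ∣) (sym (proj₁ (Mid⊆Up (∁ T) t)))) (trans (∣∁∣+∣∣ T) (sym h+h≡n)))

  vA = count A.Down?
  vB = count B.Down?

  p≤ : p ≤ count (A.Below? h) + count A.Above?
  p≤ = ≤-trans (Fin≤-count (Mem? a) a (λ i → i , refl) (λ _ _ → a-inj)) A.count-A
  q≤ : q ≤ y + vB
  q≤ = ≤-trans (≤-trans (Fin≤-count (Mem? b) b (λ i → i , refl) (λ _ _ → b-inj)) B.count-A) (+-mono-≤ BelowB≤y B.Above≤Down)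
  vA+∇U≤K : vA + ∇U ≤ K
  vA+∇U≤K = ≤-trans (A.Down+Shade (A.Up h) (A.Up? h) (λ _ u → u)) (≤-reflexive rank-K)
  vB+∇Y≤K : vB + ∇Y ≤ K
  vB+∇Y≤K = ≤-trans (B.Down+Shade Mid Mid? Mid⊆Up) (≤-reflexive rank-K)
  Px≤∇U : P h h x ≤ ∇U
  Px≤∇U = A.P≤Shade (A.Up h) (A.Up? h) (λ _ u → u)
  Py≤∇Y : P h h y ≤ ∇Y
  Py≤∇Y = B.P≤Shade Mid Mid? Mid⊆Up

  below≤ = A.Below≤Up h n≡ (inc a a-anti) h ≤-refl

  -- As κ* is a minimum, each j ≤ k turns the hypothesis on the total into a lower bound, here freed
  -- of subtraction. It is used for j = 0 and for the actual excess.
  lower : ∀ j → j ≤ k → j ≤ N → N + K + j ≤ p + q + P h h j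
  lower j j≤k j≤N = ℤ-bound (p + q) N K (κ* h k) (P h h j) j
    (trans total (cong₂ (λ s t → (+ s ℤ.+ + t) - κ* h k)
      (trans (cong (_C h) (sym h+h≡n)) (sym (c≡C h h)))
      (trans (cong (_C suc h) (trans (sym h'+≡n) (+-comm h' (suc h)))) (trans (sym (c≡C (suc h) h')) (c-comm (suc h) h')))))
    (ℤₚ.≤-trans (κ*≤κ h j≤k) (ℤₚ.≤-reflexive (cong (λ s → + s - + j) (shadowSum≡P h h j j≤N))))

  excess : ∃ λ j → x + y ≡ N + j
  excess with compare-+ (x + y) N
  ... | inj₂ r = r
  ... | inj₁ l with m≤n⇒m<n∨m≡n l
  ... | inj₂ e = 0 , trans e (sym (+-identityʳ N))
  ... | inj₁ lt = contradiction
    (lin (N ∷ P h h x ∷ P h h y ∷ x ∷ y ∷ K ∷ p ∷ q ∷ count (A.Below? h) ∷ count A.Above? ∷ vA ∷ vB ∷ ∇U ∷ ∇Y ∷ P h h 0 ∷ [])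
      (λ N px py x y K p q bA aA vA vB U Y z → N :+ K :+ lit 0 :≤ p :+ q :+ z ⇒ z :≡ lit 0 ⇒ p :≤ bA :+ aA ⇒ bA :≤ x ⇒ aA :≤ vA ⇒
         q :≤ y :+ vB ⇒ vA :+ U :≤ K ⇒ vB :+ Y :≤ K ⇒ px :≤ U ⇒ py :≤ Y ⇒ goal (N :+ px :+ py) (x :+ y :+ K))
      (lower 0 z≤n z≤n) (P-zero h h) p≤ (proj₁ below≤) A.Above≤Down q≤ vA+∇U≤K vB+∇Y≤K Px≤∇U Py≤∇Y)
    (no-small-total h' x y x≤N y≤N lt)

  j = proj₁ excess
  xy≡ = proj₂ excess
  j≤k : j ≤ k
  j≤k = +-cancelˡ-≤ N _ _ (≤-trans (≤-reflexive (sym xy≡)) x+y≤N+k)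
  j≤N : j ≤ N
  j≤N = +-cancelˡ-≤ N _ _ (≤-trans (≤-reflexive (sym xy≡)) (+-mono-≤ x≤N y≤N))
  low = lower j j≤k j≤N
  Pxy = P-intersection h h x≤N y≤N xy≡

  -- With `low` and `Pxy` the upper estimates for p + q close up into a cycle, so each of them is an
  -- equality. This reversed estimate, `K≤vA+∇U` and `∇U≤Px` are each obtained by adding up all
  -- links of the cycle but the one in question.
  x+vA≤p : x + vA ≤ p
  x+vA≤p = lin (N ∷ P h h x ∷ P h h y ∷ x ∷ y ∷ K ∷ p ∷ q ∷ vA ∷ vB ∷ ∇U ∷ ∇Y ∷ P h h j ∷ j ∷ [])
    (λ N px py x y K p q vA vB U Y pj j → N :+ K :+ j :≤ p :+ q :+ pj ⇒ K :+ pj :≤ px :+ py ⇒ x :+ y :≡ N :+ j ⇒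
       q :≤ y :+ vB ⇒ vA :+ U :≤ K ⇒ vB :+ Y :≤ K ⇒ px :≤ U ⇒ py :≤ Y ⇒ goal (x :+ vA) p)
    low Pxy xy≡ q≤ vA+∇U≤K vB+∇Y≤K Px≤∇U Py≤∇Y

  p≤x+vA : p ≤ x + vA
  p≤x+vA = ≤-trans p≤ (+-mono-≤ (proj₁ below≤) A.Above≤Down)

  K≤vA+∇U : K ≤ vA + ∇U
  K≤vA+∇U = lin (N ∷ P h h x ∷ P h h y ∷ x ∷ y ∷ K ∷ p ∷ q ∷ vA ∷ vB ∷ ∇U ∷ ∇Y ∷ P h h j ∷ j ∷ [])
    (λ N px py x y K p q vA vB U Y pj j → N :+ K :+ j :≤ p :+ q :+ pj ⇒ K :+ pj :≤ px :+ py ⇒ x :+ y :≡ N :+ j ⇒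
       p :≤ x :+ vA ⇒ q :≤ y :+ vB ⇒ vB :+ Y :≤ K ⇒ px :≤ U ⇒ py :≤ Y ⇒ goal K (vA :+ U))
    low Pxy xy≡ p≤x+vA q≤ vB+∇Y≤K Px≤∇U Py≤∇Y

  ∇U≤Px : ∇U ≤ P h h x
  ∇U≤Px = lin (N ∷ P h h x ∷ P h h y ∷ x ∷ y ∷ K ∷ p ∷ q ∷ vA ∷ vB ∷ ∇U ∷ ∇Y ∷ P h h j ∷ j ∷ [])
    (λ N px py x y K p q vA vB U Y pj j → N :+ K :+ j :≤ p :+ q :+ pj ⇒ K :+ pj :≤ px :+ py ⇒ x :+ y :≡ N :+ j ⇒
       p :≤ x :+ vA ⇒ q :≤ y :+ vB ⇒ vA :+ U :≤ K ⇒ vB :+ Y :≤ K ⇒ py :≤ Y ⇒ goal U px)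
    low Pxy xy≡ p≤x+vA q≤ vA+∇U≤K vB+∇Y≤K Py≤∇Y

  not-below : ∀ S → Mem a S → ¬ ∣ S ∣ < h
  not-below S m l = n≮n p (lin (x ∷ vA ∷ p ∷ count (A.Below? h) ∷ count A.Above? ∷ [])
    (λ x v p b a → x :+ v :≤ p ⇒ p :≤ b :+ a ⇒ lit 1 :+ b :≤ x ⇒ a :≤ v ⇒ goal (lit 1 :+ p) p)
    x+vA≤p p≤ (proj₂ below≤ S m l) A.Above≤Down)

  not-above : ∀ S → Mem a S → ¬ suc h < ∣ S ∣
  not-above S m l = n≮n p (lin (x ∷ vA ∷ p ∷ count (A.Below? h) ∷ count A.Above? ∷ [])
    (λ x v p b a → x :+ v :≤ p ⇒ p :≤ b :+ a ⇒ b :≤ x ⇒ lit 1 :+ a :≤ v ⇒ goal (lit 1 :+ p) p)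
    x+vA≤p p≤ (proj₁ below≤) (A.Above<Down S m l))

  size : ∀ S → Mem a S → ∣ S ∣ ≡ h ⊎ ∣ S ∣ ≡ suc h
  size S m = between (not-below S m) (not-above S m)

  Up⇒Level : ∀ T → A.Up h T → Level a h T
  Up⇒Level T (e , S , m , S⊆T) = subst (Mem a) (⊆∧≥⇒≡ S T S⊆T (≤-trans (≤-reflexive e) (≮⇒≥ (not-below S m)))) m , e

  Level⇒Up : ∀ T → Level a h T → A.Up h T
  Level⇒Up T (m , e) = e , T , m , ⊆-refl

  count-Level : count (Level? a h) ≡ x
  count-Level = count-cong (Level? a h) (A.Up? h) Level⇒Up Up⇒Level

  count-Shade : count (Shade? h (Level? a h)) ≡ ∇U
  count-Shade = count-cong (Shade? h (Level? a h)) (Shade? h (A.Up? h))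
    (λ T (e , S , m , l) → e , S , Level⇒Up S m , l) (λ T (e , S , m , l) → e , S , Up⇒Level S m , l)

  Cover? : Decidable (λ T → A.Down T ⊎ Shade h (A.Up h) T)
  Cover? T = A.Down? T ⊎-dec Shade? h (A.Up? h) T

  -- The two families are disjoint and their sizes add up to that of level h + 1, so they fill it.
  covered : ∀ T → ∣ T ∣ ≡ suc h → A.Down T ⊎ Shade h (A.Up h) T
  covered = count-full Cover? (Rank? (suc h)) (λ { T (inj₁ d) → A.Down-rank T d ; T (inj₂ s) → proj₁ s })
    (≤-trans (≤-reflexive rank-K) (≤-trans K≤vA+∇U
      (count-⊎ A.Down? (Shade? h (A.Up? h)) Cover? (λ _ → inj₁) (λ _ → inj₂) (A.Down-Shade-disjoint (A.Up h) (A.Up? h) (λ _ u → u)))))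

  forward : ∀ S → Mem a S → Level a h S ⊎ (∣ S ∣ ≡ suc h × ¬ Shade h (Level a h) S)
  forward S m = Sum.map (m ,_)
    (λ e → e , λ (_ , T , (m' , _) , T⊂S) → inc a a-anti T S m' m T⊂S) (size S m)

  Down⇒Mem : ∀ S → ∣ S ∣ ≡ suc h → A.Down S → Mem a S
  Down⇒Mem S e d = let (T , m , S⊆T) = A.Down-member S d in
    subst (Mem a) (sym (⊆∧≥⇒≡ S T S⊆T (≤-trans (≮⇒≥ (not-above T m)) (≤-reflexive (sym e))))) m

  backward : ∀ S → Level a h S ⊎ (∣ S ∣ ≡ suc h × ¬ Shade h (Level a h) S) → Mem a S
  backward S (inj₁ (m , _)) = m
  backward S (inj₂ (e , ¬s)) = Sum.[ Down⇒Mem S e ,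
    (λ (_ , T , u , T⊂S) → contradiction (e , T , Up⇒Level T u , T⊂S) ¬s) ]′ (covered S e)

  shade-L : count (Shade? h (L? n h x)) ≡ P h h x
  shade-L = ≤-antisym (Shade-L h h h+h≡n x)
    (≤-trans (P-mono h h (count-L h h h+h≡n x x≤N)) (Kruskal–Katona h h (L n h x) (L? n h x) h+h≡n (λ _ → proj₁)))

  conclusion : Conclusion n h a
  conclusion = (λ i → size (a i) (i , refl)) , (λ S → forward S , backward S) ,
    trans count-Shade (trans (≤-antisym ∇U≤Px Px≤∇U)
      (trans (sym shade-L) (cong (λ m → count (Shade? h (L? n h m))) (sym count-Level))))

theorem2p6 : ∀ (n h : ℕ) → n ≡ 2 * h → 4 ≤ n →
    ∀ (p q : ℕ) (a : Fin p → Subset n) (b : Fin q → Subset n) →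
    Injective _≡_ _≡_ a → Injective _≡_ _≡_ b →
    Antichain a → Antichain b →
    ∀ (k : ℕ) → k ≤ p → k ≤ q →
    (∀ i j → a i ∩ b j ≡ ⊥ → toℕ i ≡ toℕ j × suc (toℕ i) ≤ k) →
    + (p + q) ≡ (+ (n C h) ℤ.+ + (n C suc h)) - κ* h k →
    Conclusion n h a × Conclusion n h b
theorem2p6 n zero refl ()
theorem2p6 n (suc h') n≡ _ p q a b a-inj b-inj a-anti b-anti k _ _ cross total =
  half-conclusion h' n≡ a b a-inj b-inj a-anti b-anti k cross total ,
  half-conclusion h' n≡ b a b-inj a-inj b-anti a-anti k cross′ (trans (cong +_ (+-comm q p)) total)
  where
  cross′ : ∀ j i → b j ∩ a i ≡ ⊥ → toℕ j ≡ toℕ i × suc (toℕ j) ≤ k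
  cross′ j i e = let (i≡j , i<k) = cross i j (trans (∩-comm (a i) (b j)) e) in
    sym i≡j , subst (λ m → suc m ≤ k) i≡j i<k
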